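{- For every positive integer $n$ there is a graph $U_n$ of treewidth at most $3$ with at most $n^{20\log_2 n}$ vertices that contains every $n$-vertex graph of treewidth at most $2$ as a subgraph.
   Context: "$U$ contains $H$ as a subgraph" means $U$ has a subgraph isomorphic to $H$. Treewidth is the usual notion. -}

module Defs where

open import Data.Nat using (ℕ; zero; suc; _+_; _*_; _^_; _≤_; _<_)
open import Data.Fin using (Fin; zero; suc; inject₁; fromℕ)
open import Data.Fin.Subset using (Subset; _∈_; ∣_∣)
open import Data.Bool using (Bool; true; false)
open import Data.Product using (Σ; ∃; _×_; _,_)
open import Data.Unit using (⊤)
open import Data.Empty using (⊥)
open import Relation.Nullary using (¬_)
open import Relation.Binary.PropositionalEquality using (_≡_)
open import Function.Definitions using (Injective)

record Graph (n : ℕ) : Set where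
  field
    adj    : Fin n → Fin n → Bool
    sym    : ∀ u v → adj u v ≡ adj v u
    irrefl : ∀ v → adj v v ≡ false
open Graph public

Adj : ∀ {n} → Graph n → Fin n → Fin n → Set
Adj G u v = adj G u v ≡ true

data WalkIn {n : ℕ} (G : Graph n) (P : Fin n → Set) : Fin n → Fin n → Set where
  here : ∀ {u} → P u → WalkIn G P u u
  step : ∀ {u v w} → P u → Adj G u v → WalkIn G P v w → WalkIn G P u w

Connected : ∀ {n} → Graph n → Set
Connected G = ∀ u v → WalkIn G (λ _ → ⊤) u v

record Cycle {n : ℕ} (G : Graph n) (k : ℕ) : Set where
  field
    vert  : Fin (suc (suc (suc k))) → Fin n
    inj   : Injective _≡_ _≡_ vert
    cons  : ∀ (i : Fin (suc (suc k))) → Adj G (vert (inject₁ i)) (vert (suc i))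
    close : Adj G (vert (fromℕ (suc (suc k)))) (vert zero)

Acyclic : ∀ {n} → Graph n → Set
Acyclic G = ∀ k → ¬ Cycle G k

IsTree : ∀ {m} → Graph (suc m) → Set
IsTree T = Connected T × Acyclic T

record TreeDecomposition {n m : ℕ} (G : Graph n) (T : Graph (suc m)) : Set where
  field
    isTree   : IsTree T
    bag      : Fin (suc m) → Subset n
    covV     : ∀ v → ∃ λ t → v ∈ bag t
    covE     : ∀ u v → Adj G u v → ∃ λ t → (u ∈ bag t × v ∈ bag t)
    subtree  : ∀ v t₁ t₂ → v ∈ bag t₁ → v ∈ bag t₂ →
               WalkIn T (λ t → v ∈ bag t) t₁ t₂
open TreeDecomposition public

WidthAtMost : ∀ {n m} {G : Graph n} {T : Graph (suc m)} → ℕ → TreeDecomposition G T → Set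
WidthAtMost k D = ∀ t → ∣ bag D t ∣ ≤ suc k

TreewidthAtMost : ∀ {n} → ℕ → Graph n → Set
TreewidthAtMost {n} k G =
  Σ ℕ λ m → Σ (Graph (suc m)) λ T → Σ (TreeDecomposition G T) λ D → WidthAtMost k D

SubgraphOf : ∀ {n N} → Graph n → Graph N → Set
SubgraphOf {n} {N} H U =
  Σ (Fin n → Fin N) λ f → Injective _≡_ _≡_ f × (∀ u v → Adj H u v → Adj U (f u) (f v))

-- N ≤ n ^ (20 · log₂ n)  (real exponent), for n ≥ 1, stated exactly using
-- rationals: with b = log₂ N, a = log₂ n ≥ 0, the condition is b ≤ 20 a², i.e.
-- every rational p/q ≥ 0 with p/q < b (⇔ 2^p < N^q) satisfies p/q < 20 (s/t)²
-- for some rational s/t ≥ 0 with s/t ≤ a (⇔ 2^s ≤ n^t).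
PowLogBound : ℕ → ℕ → Set
PowLogBound N n =
  ∀ p q → 1 ≤ q → 2 ^ p < N ^ q →
    ∃ λ s → ∃ λ t → 1 ≤ t × 2 ^ s ≤ n ^ t × p * (t * t) < 20 * (s * s) * q

{-# OPTIONS --safe #-}
module Submission where

-- A graph of treewidth at most 2 is a subgraph of a 2-tree, and a 2-tree on a
-- base edge is a ternary tree: the first new vertex c on the edge ab leaves a
-- 2-tree on each of ac, cb and ab.  Of these three parts at most one is heavy
-- (at least half of the whole), so following heavy parts gives a sequence of
-- edges, consecutive ones sharing a vertex, with only light parts hanging off.
-- This sequence is a chain of fans with pivots p₀, p₁, p₂, …, where the fan
-- around pᵢ₊₁ is joined to a path of unknown length from pᵢ to pᵢ₊₂.  The one
-- extra unit of width makes the host independent of these lengths: it has the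
-- triangles pᵢ pᵢ₊₁ pᵢ₊₂ as a spine and, on each of them, a long path starting
-- at pᵢ, all of whose vertices are joined to both pᵢ₊₁ and pᵢ₊₂, so that the
-- fan can use a prefix of any length and then step to pᵢ₊₂.  Light parts go
-- recursively into copies of the host for half the size; there are polynomially
-- many copies and logarithmically many levels.

open import Defs
open import Data.Bool using (Bool; true; false)
import Data.Bool.Properties as Bool
open import Data.Empty using (⊥-elim)
open import Data.Fin using (Fin; zero; suc; inject₁; fromℕ; toℕ; fromℕ<)
open import Data.Fin.Patterns using (0F; 1F; 2F; 3F)
open import Data.Fin.Properties using (_≟_; any?; suc-injective; injective⇒≤; toℕ-injective; toℕ-inject₁; toℕ-fromℕ; toℕ-fromℕ<; toℕ<n)
open import Data.Fin.Relation.Unary.Top using (view; ‵fromℕ; ‵inject₁)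
open import Data.Fin.Subset using (Subset; _∈_; _⊆_; ∣_∣; ⁅_⁆; _∪_; inside; outside)
open import Data.Fin.Subset.Properties using (x∈⁅x⁆; x∈⁅y⁆⇒x≡y; x∈p∪q⁺; x∈p∪q⁻; ∣⁅x⁆∣≡1)
open import Data.List using (List; []; _∷_; length; filter; map; allFin)
import Data.List as List
open import Data.List.Membership.DecPropositional using () renaming (_∈?_ to mem?)
open import Data.List.Membership.Propositional using (find; lose) renaming (_∈_ to _∈ₗ_; _∉_ to _∉ₗ_)
open import Data.List.Membership.Propositional.Properties using (∈-filter⁺; ∈-filter⁻; ∈-map⁺; ∈-map⁻; ∈-lookup; ∈-allFin)
open import Data.List.Properties using (length-map; filter-notAll)
import Data.List.Relation.Unary.All as All
open import Data.List.Relation.Unary.AllPairs using ([]; _∷_)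
open import Data.List.Relation.Unary.Any as Any using (here; there)
open import Data.List.Relation.Unary.Unique.Propositional using (Unique)
import Data.List.Relation.Unary.Unique.Propositional.Properties as Unique
open import Data.Nat using (ℕ; zero; suc; _≤_; _<_; s≤s; z≤n; _+_; _*_; _^_; _<?_)
import Data.Nat.Properties as ℕₚ
open import Data.Nat.Tactic.RingSolver using (solve-∀)
open import Data.Product using (Σ; ∃; _×_; _,_; proj₁; proj₂)
open import Data.Sum as Sum using (_⊎_; inj₁; inj₂; [_,_]′)
open import Data.Unit using (⊤; tt)
open import Data.Vec using ([]; _∷_; here; there; lookup)
open import Data.Vec.Properties using (lookup⇒[]=; []=⇒lookup)
open import Function using (_∘_; id)
open import Function.Definitions using (Injective)
open import Relation.Binary.PropositionalEquality as ≡ using (_≡_; _≢_; refl; cong; cong₂; subst; subst₂)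
open import Relation.Nullary using (¬_; Dec; yes; no; ¬?; _×-dec_)
open import Relation.Nullary.Decidable using (decidable-stable)

-- Walks, and adding a leaf to a tree decomposition

walk-map : ∀ {n m} {G : Graph n} {G′ : Graph m} {P : Fin n → Set} {P′ : Fin m → Set} (f : Fin n → Fin m) →
           (∀ {u v} → Adj G u v → Adj G′ (f u) (f v)) → (∀ {u} → P u → P′ (f u)) →
           ∀ {u v} → WalkIn G P u v → WalkIn G′ P′ (f u) (f v)
walk-map f a p (here pu)      = here (p pu)
walk-map f a p (step pu uv w) = step (p pu) (a uv) (walk-map f a p w)

walk-++ : ∀ {n} {G : Graph n} {P : Fin n → Set} {u v w} → WalkIn G P u v → WalkIn G P v w → WalkIn G P u w
walk-++ (here _)      w′ = w′
walk-++ (step p uv w) w′ = step p uv (walk-++ w w′)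

Adj-sym : ∀ {n} (G : Graph n) {u v} → Adj G u v → Adj G v u
Adj-sym G {u} {v} uv = ≡.trans (Graph.sym G v u) uv

Adj-irrefl : ∀ {n} (G : Graph n) {v} → ¬ Adj G v v
Adj-irrefl G {v} vv with ≡.trans (≡.sym vv) (irrefl G v)
... | ()

-- Serves in two roles: with `X` inside a bag it enlarges the decomposed graph, with `X` a singleton
-- it adds a leaf to the decomposition tree.
addVertex : ∀ {n} → Graph n → Subset n → Graph (suc n)
addVertex {n} G X = record { adj = a ; sym = s ; irrefl = i }
  where
  a : Fin (suc n) → Fin (suc n) → Bool
  a zero    zero    = false
  a zero    (suc v) = lookup X v
  a (suc u) zero    = lookup X u
  a (suc u) (suc v) = adj G u v
  s : ∀ u v → a u v ≡ a v u
  s zero    zero    = refl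
  s zero    (suc v) = refl
  s (suc u) zero    = refl
  s (suc u) (suc v) = Graph.sym G u v
  i : ∀ v → a v v ≡ false
  i zero    = refl
  i (suc v) = irrefl G v

cycle-neighbours : ∀ {n k} {G : Graph n} (c : Cycle G k) (i : Fin (suc (suc (suc k)))) → let open Cycle c in
                   ∃ λ j → ∃ λ j′ → j ≢ j′ × Adj G (vert i) (vert j) × Adj G (vert i) (vert j′)
cycle-neighbours {k = k} {G} c i with view i
... | ‵fromℕ = zero , inject₁ (fromℕ (suc k)) , (λ ()) , Cycle.close c , Adj-sym G (Cycle.cons c (fromℕ (suc k)))
... | ‵inject₁ zero = suc zero , fromℕ _ , (λ ()) , Cycle.cons c zero , Adj-sym G (Cycle.close c)
... | ‵inject₁ (suc j) = suc (suc j) , inject₁ (inject₁ j) , distinct , Cycle.cons c (suc j) , Adj-sym G (Cycle.cons c (inject₁ j))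
  where
  distinct : suc (suc j) ≢ inject₁ (inject₁ j)
  distinct e = ℕₚ.m≢1+n+m (toℕ j) {1} (≡.trans (≡.sym (≡.trans (toℕ-inject₁ (inject₁ j)) (toℕ-inject₁ j))) (≡.sym (cong toℕ e)))

-- The new vertex has `t` as its only neighbour, while a vertex on a cycle has two. So every cycle
-- avoids it and already lies in `T`.
leaf-acyclic : ∀ {m} (T : Graph m) t → Acyclic T → Acyclic (addVertex T ⁅ t ⁆)
leaf-acyclic T t acyclic k c with any? (λ i → Cycle.vert c i ≟ zero)
... | yes (i , vi≡0) = let j , j′ , j≢j′ , ij , ij′ = cycle-neighbours c i in
        j≢j′ (inj (≡.trans (only (subst (λ v → Adj T′ v (vert j)) vi≡0 ij)) (≡.sym (only (subst (λ v → Adj T′ v (vert j′)) vi≡0 ij′)))))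
  where
  T′ = addVertex T ⁅ t ⁆
  open Cycle c
  only : ∀ {v} → Adj T′ zero v → v ≡ suc t
  only {suc v} e = cong suc (x∈⁅y⁆⇒x≡y t (lookup⇒[]= v ⁅ t ⁆ e))
... | no avoids = acyclic k record
  { vert  = proj₁ ∘ old
  ; inj   = λ {i} {j} e → inj (≡.trans (proj₂ (old i)) (≡.trans (cong suc e) (≡.sym (proj₂ (old j)))))
  ; cons  = λ i → subst₂ (Adj T′) (proj₂ (old (inject₁ i))) (proj₂ (old (suc i))) (cons i)
  ; close = subst₂ (Adj T′) (proj₂ (old _)) (proj₂ (old zero)) close
  }
  where
  T′ = addVertex T ⁅ t ⁆
  open Cycle c
  old : ∀ i → ∃ λ w → vert i ≡ suc w
  old i with vert i in e
  ... | zero  = ⊥-elim (avoids (i , e))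
  ... | suc w = w , refl

module _ {n m} {G : Graph n} {T : Graph (suc m)} (D : TreeDecomposition G T)
         (t : Fin (suc m)) {X : Subset n} (X⊆ : X ⊆ bag D t) where

  private
    T′ : Graph (suc (suc m))
    T′ = addVertex T ⁅ t ⁆

    0~t : Adj T′ zero (suc t)
    0~t = []=⇒lookup (x∈⁅x⁆ t)

    bag′ : Fin (suc (suc m)) → Subset (suc n)
    bag′ zero    = inside ∷ X
    bag′ (suc s) = outside ∷ bag D s

    old : ∀ {P : Fin (suc m) → Set} {P′ : Fin (suc (suc m)) → Set} → (∀ {s} → P s → P′ (suc s)) →
          ∀ {u v} → WalkIn T P u v → WalkIn T′ P′ (suc u) (suc v)
    old = walk-map suc (λ uv → uv)

    conn : Connected T′
    conn zero    zero    = here tt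
    conn zero    (suc v) = step tt 0~t (old _ (proj₁ (isTree D) t v))
    conn (suc u) zero    = walk-++ (old _ (proj₁ (isTree D) u t)) (step tt 0~t (here tt))
    conn (suc u) (suc v) = old _ (proj₁ (isTree D) u v)

    subtree′ : ∀ v t₁ t₂ → v ∈ bag′ t₁ → v ∈ bag′ t₂ → WalkIn T′ (λ s → v ∈ bag′ s) t₁ t₂
    subtree′ v       zero     zero     p q = here p
    subtree′ (suc v) zero     (suc t₂) (there p) (there q) =
      step (there p) 0~t (old there (subtree D v t t₂ (X⊆ p) q))
    subtree′ (suc v) (suc t₁) zero     (there p) (there q) =
      walk-++ (old there (subtree D v t₁ t p (X⊆ q))) (step (there (X⊆ q)) 0~t (here (there q)))
    subtree′ (suc v) (suc t₁) (suc t₂) (there p) (there q) = old there (subtree D v t₁ t₂ p q)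

    covE′ : ∀ u v → Adj (addVertex G X) u v → ∃ λ s → (u ∈ bag′ s × v ∈ bag′ s)
    covE′ zero    (suc v) uv = zero , here , there (lookup⇒[]= v X uv)
    covE′ (suc u) zero    uv = zero , there (lookup⇒[]= u X uv) , here
    covE′ (suc u) (suc v) uv with covE D u v uv
    ... | s , p , q = suc s , there p , there q

    covV′ : ∀ v → ∃ λ s → v ∈ bag′ s
    covV′ zero    = zero , here
    covV′ (suc v) with covV D v
    ... | s , p = suc s , there p

  -- The new bag hangs at `t`. Its old vertices all lie in the bag of `t`, so the bags holding such
  -- a vertex stay connected.
  addLeaf : TreeDecomposition (addVertex G X) (addVertex T ⁅ t ⁆)
  addLeaf = record { isTree = conn , leaf-acyclic T t (proj₂ (isTree D)) ; bag = bag′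
                   ; covV = covV′ ; covE = covE′ ; subtree = subtree′ }

  addLeaf-width : ∀ {k} → WidthAtMost k D → ∣ X ∣ ≤ k → WidthAtMost k addLeaf
  addLeaf-width w X≤k zero    = s≤s X≤k
  addLeaf-width w X≤k (suc s) = w s

-- Hosts of treewidth 3

Slot : Set
Slot = Fin 4

-- The current bag has four slots (vertices may repeat).  new a b c p adds a vertex
-- joined to slots a, b, c; in p it is slot 0 and these three are slots 1, 2, 3.
data Prog : Set where
  done : Prog
  _∥_  : Prog → Prog → Prog
  new  : (a b c : Slot) → Prog → Prog

infixr 5 _∥_

data Spot : Prog → Set where
  left  : ∀ {p q} → Spot p → Spot (p ∥ q)
  right : ∀ {p q} → Spot q → Spot (p ∥ q)
  fresh : ∀ {a b c p} → Spot (new a b c p)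
  below : ∀ {a b c p} → Spot p → Spot (new a b c p)

left-injective : ∀ {p q} → Injective _≡_ _≡_ (left {p} {q})
left-injective refl = refl

right-injective : ∀ {p q} → Injective _≡_ _≡_ (right {p} {q})
right-injective refl = refl

below-injective : ∀ {a b c p} → Injective _≡_ _≡_ (below {a} {b} {c} {p})
below-injective refl = refl

cost : Prog → ℕ
cost done          = 0
cost (p ∥ q)       = cost p + cost q
cost (new a b c p) = suc (cost p)

module _ {H : Set} where

  newBag : H → H → H → H → Slot → H
  newBag w x y z 0F = w
  newBag w x y z 1F = x
  newBag w x y z 2F = y
  newBag w x y z 3F = z

  -- The adjacencies that `p` guarantees, when started in the bag `ρ`, for its vertices placed by
  -- `h`. Embeddings into hosts rely on these alone.
  Good : (H → H → Set) → (p : Prog) → (Slot → H) → (Spot p → H) → Set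
  Good R done          ρ h = ⊤
  Good R (p ∥ q)       ρ h = Good R p ρ (h ∘ left) × Good R q ρ (h ∘ right)
  Good R (new a b c p) ρ h =
    R (h fresh) (ρ a) × R (h fresh) (ρ b) × R (h fresh) (ρ c) ×
    Good R p (newBag (h fresh) (ρ a) (ρ b) (ρ c)) (h ∘ below)

Good-map : ∀ {H H′ : Set} {R : H → H → Set} {R′ : H′ → H′ → Set} (f : H → H′) → (∀ {u v} → R u v → R′ (f u) (f v)) →
           ∀ p {ρ ρ′ h} → (∀ i → f (ρ i) ≡ ρ′ i) → Good R p ρ h → Good R′ p ρ′ (f ∘ h)
Good-map f m done    e g = tt
Good-map f m (p ∥ q) e (g , g′) = Good-map f m p e g , Good-map f m q e g′
Good-map {R′ = R′} f m (new a b c p) {h = h} e (ra , rb , rc , g) =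
  to a ra , to b rb , to c rc , Good-map f m p (λ { 0F → refl ; 1F → e a ; 2F → e b ; 3F → e c }) g
  where
  to = λ i r → subst (R′ (f (h fresh))) (e i) (m r)

∣p∪q∣≤∣p∣+∣q∣ : ∀ {n} (p q : Subset n) → ∣ p ∪ q ∣ ≤ ∣ p ∣ + ∣ q ∣
∣p∪q∣≤∣p∣+∣q∣ []          []          = z≤n
∣p∪q∣≤∣p∣+∣q∣ (true ∷ p)  (true ∷ q)  = s≤s (ℕₚ.≤-trans (∣p∪q∣≤∣p∣+∣q∣ p q) (ℕₚ.+-monoʳ-≤ ∣ p ∣ (ℕₚ.n≤1+n ∣ q ∣)))
∣p∪q∣≤∣p∣+∣q∣ (true ∷ p)  (false ∷ q) = s≤s (∣p∪q∣≤∣p∣+∣q∣ p q)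
∣p∪q∣≤∣p∣+∣q∣ (false ∷ p) (true ∷ q)  = ℕₚ.≤-trans (s≤s (∣p∪q∣≤∣p∣+∣q∣ p q)) (ℕₚ.≤-reflexive (≡.sym (ℕₚ.+-suc ∣ p ∣ ∣ q ∣)))
∣p∪q∣≤∣p∣+∣q∣ (false ∷ p) (false ∷ q) = ∣p∪q∣≤∣p∣+∣q∣ p q

record Host : Set where
  field
    {order nodes} : ℕ
    graph  : Graph order
    tree   : Graph (suc nodes)
    decomp : TreeDecomposition graph tree
    width  : WidthAtMost 3 decomp
open Host

-- `κ` finds, for each bag of `A`, a bag of `B` that still contains it, so that further vertices can
-- be attached there after others have been added.
record _⊑_ (A B : Host) : Set where
  field
    ι     : Fin (order A) → Fin (order B)
    ι-inj : Injective _≡_ _≡_ ι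
    ι-adj : ∀ {u v} → Adj (graph A) u v → Adj (graph B) (ι u) (ι v)
    κ     : Fin (suc (nodes A)) → Fin (suc (nodes B))
    κ-bag : ∀ {v t} → v ∈ bag (decomp A) t → ι v ∈ bag (decomp B) (κ t)
open _⊑_

⊑-refl : ∀ {A} → A ⊑ A
⊑-refl = record { ι = id ; ι-inj = id ; ι-adj = id ; κ = id ; κ-bag = id }

⊑-trans : ∀ {A B C} → A ⊑ B → B ⊑ C → A ⊑ C
⊑-trans e e′ = record { ι = ι e′ ∘ ι e ; ι-inj = ι-inj e ∘ ι-inj e′ ; ι-adj = ι-adj e′ ∘ ι-adj e
                      ; κ = κ e′ ∘ κ e ; κ-bag = κ-bag e′ ∘ κ-bag e }

module _ (A : Host) (t : Fin (suc (nodes A))) {x y z : Fin (order A)}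
         (x∈ : x ∈ bag (decomp A) t) (y∈ : y ∈ bag (decomp A) t) (z∈ : z ∈ bag (decomp A) t) where
  private
    X : Subset (order A)
    X = ⁅ x ⁆ ∪ (⁅ y ⁆ ∪ ⁅ z ⁆)

    X⊆ : X ⊆ bag (decomp A) t
    X⊆ v∈ with x∈p∪q⁻ ⁅ x ⁆ _ v∈
    ... | inj₁ v∈x = subst (_∈ bag (decomp A) t) (≡.sym (x∈⁅y⁆⇒x≡y x v∈x)) x∈
    ... | inj₂ v∈yz with x∈p∪q⁻ ⁅ y ⁆ _ v∈yz
    ... | inj₁ v∈y = subst (_∈ bag (decomp A) t) (≡.sym (x∈⁅y⁆⇒x≡y y v∈y)) y∈
    ... | inj₂ v∈z = subst (_∈ bag (decomp A) t) (≡.sym (x∈⁅y⁆⇒x≡y z v∈z)) z∈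

    -- The three vertices may coincide, so a union bound is used.
    X≤3 : ∣ X ∣ ≤ 3
    X≤3 = begin
      ∣ X ∣                             ≤⟨ ∣p∪q∣≤∣p∣+∣q∣ ⁅ x ⁆ _ ⟩
      ∣ ⁅ x ⁆ ∣ + ∣ ⁅ y ⁆ ∪ ⁅ z ⁆ ∣      ≤⟨ ℕₚ.+-monoʳ-≤ ∣ ⁅ x ⁆ ∣ (∣p∪q∣≤∣p∣+∣q∣ ⁅ y ⁆ _) ⟩
      ∣ ⁅ x ⁆ ∣ + (∣ ⁅ y ⁆ ∣ + ∣ ⁅ z ⁆ ∣) ≡⟨ cong₂ _+_ (∣⁅x⁆∣≡1 x) (cong₂ _+_ (∣⁅x⁆∣≡1 y) (∣⁅x⁆∣≡1 z)) ⟩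
      3                                 ∎
      where open ℕₚ.≤-Reasoning

  extend : Host
  extend = record { graph = addVertex (graph A) X ; tree = addVertex (tree A) ⁅ t ⁆
                  ; decomp = addLeaf (decomp A) t X⊆ ; width = addLeaf-width (decomp A) t X⊆ (width A) X≤3 }

  extend-⊑ : A ⊑ extend
  extend-⊑ = record { ι = suc ; ι-inj = suc-injective ; ι-adj = id ; κ = suc ; κ-bag = there }

  extend-x : Adj (graph extend) zero (suc x) × zero ∈ bag (decomp extend) zero × suc x ∈ bag (decomp extend) zero
  extend-x = []=⇒lookup v∈ , here , there v∈
    where v∈ = x∈p∪q⁺ {q = ⁅ y ⁆ ∪ ⁅ z ⁆} (inj₁ (x∈⁅x⁆ x))
  extend-y : Adj (graph extend) zero (suc y) × suc y ∈ bag (decomp extend) zero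
  extend-y = []=⇒lookup v∈ , there v∈
    where v∈ = x∈p∪q⁺ {p = ⁅ x ⁆} (inj₂ (x∈p∪q⁺ {q = ⁅ z ⁆} (inj₁ (x∈⁅x⁆ y))))
  extend-z : Adj (graph extend) zero (suc z) × suc z ∈ bag (decomp extend) zero
  extend-z = []=⇒lookup v∈ , there v∈
    where v∈ = x∈p∪q⁺ {p = ⁅ x ⁆} (inj₂ (x∈p∪q⁺ {p = ⁅ y ⁆} (inj₂ (x∈⁅x⁆ z))))

-- `place-new` separates the vertices made by `p` from the earlier ones; this is what keeps
-- successive runs jointly injective.
record Run (p : Prog) (A : Host) (ρ : Slot → Fin (order A)) : Set where
  field
    result     : Host
    extension  : A ⊑ result
    order-eq   : order result ≡ cost p + order A
    place      : Spot p → Fin (order result)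
    place-inj  : Injective _≡_ _≡_ place
    place-new  : ∀ {s u} → place s ≢ ι extension u
    place-good : Good (Adj (graph result)) p (ι extension ∘ ρ) place
open Run

run : ∀ p A t ρ → (∀ i → ρ i ∈ bag (decomp A) t) → Run p A ρ
run done A t ρ ρ∈ = record
  { result = A ; extension = ⊑-refl ; order-eq = refl ; place = λ () ; place-inj = λ { {()} }
  ; place-new = λ { {()} } ; place-good = tt }
run (p ∥ q) A t ρ ρ∈ = record
  { result     = result r′
  ; extension  = ⊑-trans (extension r) (extension r′)
  ; order-eq   = ≡.trans (order-eq r′) (≡.trans (cong (cost q +_) (order-eq r)) (≡.trans (≡.sym (ℕₚ.+-assoc (cost q) (cost p) (order A))) (cong (_+ order A) (ℕₚ.+-comm (cost q) (cost p)))))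
  ; place      = pl
  ; place-inj  = inj
  ; place-new  = λ { {left s} e → place-new r (ι-inj (extension r′) e) ; {right s} e → place-new r′ e }
  ; place-good = Good-map (ι (extension r′)) (ι-adj (extension r′)) p (λ _ → refl) (place-good r) , place-good r′
  }
  where
  r  = run p A t ρ ρ∈
  -- The second program starts in the same slots; the bag `t` has to be followed into the result of
  -- the first.
  r′ = run q (result r) (κ (extension r) t) (ι (extension r) ∘ ρ) (κ-bag (extension r) ∘ ρ∈)
  pl : Spot (p ∥ q) → Fin (order (result r′))
  pl (left s)  = ι (extension r′) (place r s)
  pl (right s) = place r′ s
  inj : Injective _≡_ _≡_ pl
  inj {left _}  {left _}  e = cong left (place-inj r (ι-inj (extension r′) e))
  inj {left _}  {right _} e = ⊥-elim (place-new r′ (≡.sym e))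
  inj {right _} {left _}  e = ⊥-elim (place-new r′ e)
  inj {right _} {right _} e = cong right (place-inj r′ e)
run (new a b c p) A t ρ ρ∈ = record
  { result     = result r
  ; extension  = ⊑-trans (extend-⊑ A t (ρ∈ a) (ρ∈ b) (ρ∈ c)) e
  ; order-eq   = ≡.trans (order-eq r) (ℕₚ.+-suc (cost p) (order A))
  ; place      = pl
  ; place-inj  = inj
  ; place-new  = λ { {fresh} eq → zero≢suc (ι-inj e eq) ; {below s} eq → place-new r eq }
  ; place-good = ι-adj e (proj₁ ex) , ι-adj e (proj₁ ey) , ι-adj e (proj₁ ez) ,
                 Good-map id id p (λ { 0F → refl ; 1F → refl ; 2F → refl ; 3F → refl }) (place-good r)
  }
  where
  ex = extend-x A t (ρ∈ a) (ρ∈ b) (ρ∈ c)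
  ey = extend-y A t (ρ∈ a) (ρ∈ b) (ρ∈ c)
  ez = extend-z A t (ρ∈ a) (ρ∈ b) (ρ∈ c)
  zero≢suc : ∀ {n} {i : Fin n} → Fin.zero ≢ suc i
  zero≢suc ()
  r = run p (extend A t (ρ∈ a) (ρ∈ b) (ρ∈ c)) zero (newBag zero (suc (ρ a)) (suc (ρ b)) (suc (ρ c)))
          (λ { 0F → proj₁ (proj₂ ex) ; 1F → proj₂ (proj₂ ex) ; 2F → proj₂ ey ; 3F → proj₂ ez })
  e = extension r
  pl : Spot (new a b c p) → Fin (order (result r))
  pl fresh     = ι e zero
  pl (below s) = place r s
  inj : Injective _≡_ _≡_ pl
  inj {fresh}   {fresh}   _  = refl
  inj {fresh}   {below _} eq = ⊥-elim (place-new r (≡.sym eq))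
  inj {below _} {fresh}   eq = ⊥-elim (place-new r eq)
  inj {below _} {below _} eq = cong below (place-inj r eq)

point : Host
point = record
  { graph  = G
  ; tree   = G
  ; decomp = record { isTree = (λ { zero zero → here tt }) , acyclic ; bag = λ _ → inside ∷ []
                    ; covV = λ { zero → zero , here } ; covE = λ { _ _ () }
                    ; subtree = λ { zero zero zero v∈ _ → here v∈ } }
  ; width  = λ _ → s≤s z≤n
  }
  where
  G : Graph 1
  G = record { adj = λ _ _ → false ; sym = λ _ _ → refl ; irrefl = λ _ → refl }
  acyclic : Acyclic G
  acyclic k c with Cycle.close c
  ... | ()

-- Embedding 2-trees

-- A 2-tree with roots A and B, the ends of its base edge.  node l r s adds a vertex C,
-- with l on the roots A C, r on C B and s on A B.
data 2Tree : Set where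
  edge : 2Tree
  node : (l r s : 2Tree) → 2Tree

size : 2Tree → ℕ
size edge         = 0
size (node l r s) = suc (size l + size r + size s)

data Pos : 2Tree → Set where
  top  : ∀ {l r s} → Pos (node l r s)
  inˡ  : ∀ {l r s} → Pos l → Pos (node l r s)
  inʳ  : ∀ {l r s} → Pos r → Pos (node l r s)
  inˢ  : ∀ {l r s} → Pos s → Pos (node l r s)

module _ {l r s : 2Tree} where
  inˡ-injective : Injective _≡_ _≡_ (inˡ {l} {r} {s})
  inˡ-injective refl = refl
  inʳ-injective : Injective _≡_ _≡_ (inʳ {l} {r} {s})
  inʳ-injective refl = refl
  inˢ-injective : Injective _≡_ _≡_ (inˢ {l} {r} {s})
  inˢ-injective refl = refl

-- The same 2-tree with the roots A and B exchanged, so C B comes before A C.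
flip : 2Tree → 2Tree
flip edge         = edge
flip (node l r s) = node (flip r) (flip l) (flip s)

flip-involutive : ∀ t → flip (flip t) ≡ t
flip-involutive edge = refl
flip-involutive (node l r s)
  rewrite flip-involutive l | flip-involutive r | flip-involutive s = refl

size-flip : ∀ t → size (flip t) ≡ size t
size-flip edge = refl
size-flip (node l r s)
  rewrite size-flip l | size-flip r | size-flip s | ℕₚ.+-comm (size r) (size l) = refl

flipPos : ∀ {t} → Pos t → Pos (flip t)
flipPos top     = top
flipPos (inˡ x) = inʳ (flipPos x)
flipPos (inʳ x) = inˡ (flipPos x)
flipPos (inˢ x) = inˢ (flipPos x)

module _ {X : Set} {l r s : 2Tree} (c : X) (f : Pos l → X) (g : Pos r → X) (h : Pos s → X) where
  glue : Pos (node l r s) → X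
  glue top     = c
  glue (inˡ x) = f x
  glue (inʳ x) = g x
  glue (inˢ x) = h x

  glue-injective : Injective _≡_ _≡_ f → Injective _≡_ _≡_ g → Injective _≡_ _≡_ h →
                   (∀ x → f x ≢ c) → (∀ x → g x ≢ c) → (∀ x → h x ≢ c) →
                   (∀ x y → f x ≢ g y) → (∀ x y → f x ≢ h y) → (∀ x y → g x ≢ h y) →
                   Injective _≡_ _≡_ glue
  glue-injective fi gi hi fc gc hc fg fh gh {top}   {top}   e = refl
  glue-injective fi gi hi fc gc hc fg fh gh {top}   {inˡ y} e = ⊥-elim (fc y (≡.sym e))
  glue-injective fi gi hi fc gc hc fg fh gh {top}   {inʳ y} e = ⊥-elim (gc y (≡.sym e))
  glue-injective fi gi hi fc gc hc fg fh gh {top}   {inˢ y} e = ⊥-elim (hc y (≡.sym e))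
  glue-injective fi gi hi fc gc hc fg fh gh {inˡ x} {top}   e = ⊥-elim (fc x e)
  glue-injective fi gi hi fc gc hc fg fh gh {inˡ x} {inˡ y} e = cong inˡ (fi e)
  glue-injective fi gi hi fc gc hc fg fh gh {inˡ x} {inʳ y} e = ⊥-elim (fg x y e)
  glue-injective fi gi hi fc gc hc fg fh gh {inˡ x} {inˢ y} e = ⊥-elim (fh x y e)
  glue-injective fi gi hi fc gc hc fg fh gh {inʳ x} {top}   e = ⊥-elim (gc x e)
  glue-injective fi gi hi fc gc hc fg fh gh {inʳ x} {inˡ y} e = ⊥-elim (fg y x (≡.sym e))
  glue-injective fi gi hi fc gc hc fg fh gh {inʳ x} {inʳ y} e = cong inʳ (gi e)
  glue-injective fi gi hi fc gc hc fg fh gh {inʳ x} {inˢ y} e = ⊥-elim (gh x y e)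
  glue-injective fi gi hi fc gc hc fg fh gh {inˢ x} {top}   e = ⊥-elim (hc x e)
  glue-injective fi gi hi fc gc hc fg fh gh {inˢ x} {inˡ y} e = ⊥-elim (fh y x (≡.sym e))
  glue-injective fi gi hi fc gc hc fg fh gh {inˢ x} {inʳ y} e = ⊥-elim (gh y x (≡.sym e))
  glue-injective fi gi hi fc gc hc fg fh gh {inˢ x} {inˢ y} e = cong inˢ (hi e)

flipPos-injective : ∀ {t} → Injective _≡_ _≡_ (flipPos {t})
flipPos-injective {x = top}   {top}   _ = refl
flipPos-injective {x = inˡ _} {inˡ _} e = cong inˡ (flipPos-injective (inʳ-injective e))
flipPos-injective {x = inʳ _} {inʳ _} e = cong inʳ (flipPos-injective (inˡ-injective e))
flipPos-injective {x = inˢ _} {inˢ _} e = cong inˢ (flipPos-injective (inˢ-injective e))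

-- The program of the universal host

module Programs (n : ℕ) where

  -- u builds the host for light 2-trees on a given edge.  A spare vertex receives a
  -- component of the 2-tree on x y whose two parts are both light.
  spares : (Slot → Slot → Prog) → ℕ → Slot → Slot → Prog
  spares u zero    x y = u x y
  spares u (suc k) x y = new x y y (u 1F 0F ∥ u 0F 2F) ∥ spares u k x y

  -- The fan around p from b to q, with its path beginning at b and every vertex of it
  -- joined to q, so that it can be left for q at any point.
  fan : (Slot → Slot → Prog) → ℕ → ℕ → Slot → Slot → Slot → Prog
  fan u k zero    b p q = done
  fan u k (suc m) b p q = spares u k b p ∥ u b q ∥ new b p q (u 1F 0F ∥ fan u n m 0F 2F 3F)

  -- The new vertex is the next pivot after y.
  spine : (Slot → Slot → Prog) → ℕ → Slot → Slot → Prog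
  spine u zero    x y = done
  spine u (suc i) x y = new x y y (spine u i 2F 0F ∥ fan u n n 1F 2F 0F)

  -- Level d serves 2-trees of size below `2 ^ d`. The two spines allow the heavy sequence to leave
  -- the base edge at either end.
  universal : ℕ → Slot → Slot → Prog
  universal zero    x y = done
  universal (suc d) x y = spine (universal d) n x y ∥ spine (universal d) n y x

-- Heavy sequences

module _ (M : ℕ) where
  -- The heavy sequence of edges first leaves the base edge A B by an edge at B.
  data Directed : 2Tree → Set where
    light : ∀ {t} → size t < M → Directed t
    stay  : ∀ {l r s} → size l < M → size r < M → Directed s → Directed (node l r s)
    go    : ∀ {l r s} → size l < M → Directed r ⊎ Directed (flip r) → size s < M → Directed (node l r s)

  -- A part of size at least `M` takes half of the total, which leaves less than `M` for the other
  -- two together.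
  others-light : ∀ {x y z} → suc (x + y + z) < M + M → ¬ y < M → x < M × z < M
  others-light {x} {y} {z} <2M y≮M = ℕₚ.≤-<-trans (ℕₚ.m≤m+n x z) x+z<M , ℕₚ.≤-<-trans (ℕₚ.m≤n+m z x) x+z<M
    where
    x+z<M : x + z < M
    x+z<M = ℕₚ.+-cancelʳ-< M (x + z) M (begin-strict
      x + z + M       ≤⟨ ℕₚ.+-monoʳ-≤ (x + z) (ℕₚ.≮⇒≥ y≮M) ⟩
      x + z + y       ≡⟨ ℕₚ.+-assoc x z y ⟩
      x + (z + y)     ≡⟨ cong (x +_) (ℕₚ.+-comm z y) ⟩
      x + (y + z)     ≡⟨ ≡.sym (ℕₚ.+-assoc x y z) ⟩
      x + y + z       <⟨ ℕₚ.n<1+n _ ⟩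
      suc (x + y + z) <⟨ <2M ⟩
      M + M           ∎)
      where open ℕₚ.≤-Reasoning

  -- A heavy part on C B or A C decides at which end the sequence leaves the base edge. If both are
  -- light, the base edge is kept and the decision is left to `s`.
  directed : 0 < M → ∀ t → size t < M + M → Directed t ⊎ Directed (flip t)
  directed 0<M edge _ = inj₁ (light 0<M)
  directed 0<M (node l r s) t<2M with size l <? M | size r <? M
  ... | _ | no r≮M = let l<M , s<M = others-light {size l} t<2M r≮M in
    inj₁ (go l<M (directed 0<M r (ℕₚ.<-trans (s≤s (ℕₚ.m≤n⇒m≤n+o (size s) (ℕₚ.m≤n+m (size r) (size l)))) t<2M)) s<M)
  -- The sequence leaves at A. In the flipped tree the heavy part is the one on the right, so `go`
  -- applies to it.
  ... | no l≮M | _ = let r<M , s<M = others-light {size r} t<2M′ l≮M in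
    inj₂ (go (light-flip r r<M) (twice (directed 0<M l (ℕₚ.<-trans (s≤s (ℕₚ.m≤n⇒m≤n+o (size s) (ℕₚ.m≤m+n (size l) (size r)))) t<2M))) (light-flip s s<M))
    where
    t<2M′ : suc (size r + size l + size s) < M + M
    t<2M′ = subst (λ k → suc (k + size s) < M + M) (ℕₚ.+-comm (size l) (size r)) t<2M
    light-flip : ∀ t → size t < M → size (flip t) < M
    light-flip t = subst (_< M) (≡.sym (size-flip t))
    twice : Directed l ⊎ Directed (flip l) → Directed (flip l) ⊎ Directed (flip (flip l))
    twice (inj₁ d) = inj₂ (subst Directed (≡.sym (flip-involutive l)) d)
    twice (inj₂ d) = inj₁ d
  ... | yes l<M | yes r<M with directed 0<M s (ℕₚ.<-trans (s≤s (ℕₚ.m≤n+m (size s) (size l + size r))) t<2M)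
  ...   | inj₁ d = inj₁ (stay l<M r<M d)
  ...   | inj₂ d = inj₂ (stay (subst (_< M) (≡.sym (size-flip r)) r<M) (subst (_< M) (≡.sym (size-flip l)) l<M) d)

-- Embedding 2-trees into the universal program

module Embedding {H : Set} (R : H → H → Set) (R-sym : ∀ {u v} → R u v → R v u) where

  -- The edges of the 2-tree are the leaves `edge`, so each is checked once. Injectivity of `f` is
  -- kept apart: it is settled among spots, independently of their placement.
  Real : (t : 2Tree) → H → H → (Pos t → H) → Set
  Real edge         a b f = R a b
  Real (node l r s) a b f = Real l a (f top) (f ∘ inˡ) × Real r (f top) b (f ∘ inʳ) × Real s a b (f ∘ inˢ)

  Real-flip : ∀ t {a b f} → Real (flip t) b a f → Real t a b (f ∘ flipPos)
  Real-flip edge         = R-sym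
  Real-flip (node l r s) (l′ , r′ , s′) = Real-flip l r′ , Real-flip r l′ , Real-flip s s′

  Real-ext : ∀ t {a b f g} → (∀ x → f x ≡ g x) → Real t a b f → Real t a b g
  Real-ext edge         e x = x
  Real-ext (node l r s) {f = f} {g} e (l′ , r′ , s′) =
    Real-ext l (e ∘ inˡ) (subst (λ c → Real l _ c _) (e top) l′) ,
    Real-ext r (e ∘ inʳ) (subst (λ c → Real r c _ _) (e top) r′) ,
    Real-ext s (e ∘ inˢ) s′

  -- The choice of spots is made once and works for every bag `ρ` and every placement `h` that is
  -- `Good`.
  record Embeds (t : 2Tree) (p : Prog) (x y : Slot) : Set where
    field
      pos  : Pos t → Spot p
      inj  : Injective _≡_ _≡_ pos
      real : ∀ {ρ h} → Good R p ρ h → R (ρ x) (ρ y) → Real t (ρ x) (ρ y) (h ∘ pos)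
  open Embeds

  embeds-edge : ∀ {t p x y} → size t ≤ 0 → Embeds t p x y
  embeds-edge {edge} _ = record { pos = λ () ; inj = λ { {()} } ; real = λ _ xy → xy }

  embeds-flip : ∀ {t p x y} → Embeds (flip t) p y x → Embeds t p x y
  embeds-flip {t} e = record { pos = pos e ∘ flipPos ; inj = flipPos-injective ∘ inj e
                             ; real = λ g xy → Real-flip t (real e g (R-sym xy)) }

  module Level (n : ℕ) (u : Slot → Slot → Prog) (M : ℕ)
               (embeds-u : ∀ t x y → size t < M → Embeds t (u x y) x y) where
    open Programs n

    -- Behind all the spare vertices comes a copy of `u` on `x y` itself, still free however many
    -- spares have been used.
    light-spares : ∀ {t} k {x y} → size t < M → Embeds t (spares u k x y) x y
    light-spares zero    t<M = embeds-u _ _ _ t<M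
    light-spares (suc k) t<M = record { pos = right ∘ pos e ; inj = inj e ∘ right-injective ; real = λ { (_ , g) → real e g } }
      where e = light-spares k t<M

    -- The places available to a fan around p towards q: q itself (pivot), the part of
    -- the spine past the edge p q (beyond) and the fan proper (within).
    data Region (i : ℕ) (P : Prog) : Set where
      pivot  : Region i P
      beyond : Spot (spine u i 2F 0F) → Region i P
      within : Spot P → Region i P

    beyond-injective : ∀ {i P} → Injective _≡_ _≡_ (beyond {i} {P})
    beyond-injective refl = refl

    within-injective : ∀ {i P} → Injective _≡_ _≡_ (within {i} {P})
    within-injective refl = refl

    module _ {i : ℕ} {P Q : Prog} (f : Spot P → Spot Q) where
      mapWithin : Region i P → Region i Q
      mapWithin pivot      = pivot
      mapWithin (beyond x) = beyond x
      mapWithin (within x) = within (f x)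

      mapWithin-injective : Injective _≡_ _≡_ f → Injective _≡_ _≡_ mapWithin
      mapWithin-injective fi {pivot}    {pivot}    _ = refl
      mapWithin-injective fi {beyond _} {beyond _} e = cong beyond (beyond-injective e)
      mapWithin-injective fi {within _} {within _} e = cong within (fi (within-injective e))

      mapWithin≢ : ∀ {y} → (∀ x → f x ≢ y) → ∀ z → mapWithin z ≢ within y
      mapWithin≢ f≢y (within x) e = f≢y x (within-injective e)

    placed : ∀ {i P} → H → (Spot (spine u i 2F 0F) → H) → (Spot P → H) → Region i P → H
    placed a hS h pivot      = a
    placed a hS h (beyond x) = hS x
    placed a hS h (within x) = h x

    placed-mapWithin : ∀ {i P Q a hS h} (f : Spot P → Spot Q) (z : Region i P) →
                       placed a hS (h ∘ f) z ≡ placed a hS h (mapWithin f z)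
    placed-mapWithin f pivot      = refl
    placed-mapWithin f (beyond x) = refl
    placed-mapWithin f (within x) = refl

    -- The roots of `t` lie at `b` and `p`. The spine has its own bag `ρS`, because the fan renames
    -- slots as its path advances while the spine stays at the triangle that introduced `q`; the two
    -- bags are tied together at `p` and `q`.
    record FanEmbeds (i : ℕ) (t : 2Tree) (k m : ℕ) (b p q : Slot) : Set where
      field
        pos  : Pos t → Region i (fan u k m b p q)
        inj  : Injective _≡_ _≡_ pos
        real : ∀ {ρ h ρS hS} → Good R (fan u k m b p q) ρ h → Good R (spine u i 2F 0F) ρS hS →
               ρS 2F ≡ ρ p → ρS 0F ≡ ρ q → R (ρ b) (ρ p) → R (ρ b) (ρ q) → R (ρ p) (ρ q) →
               Real t (ρ b) (ρ p) (placed (ρ q) hS h ∘ pos)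
    open FanEmbeds

    moreSpares : ∀ {k m b p q} → Spot (fan u k (suc m) b p q) → Spot (fan u (suc k) (suc m) b p q)
    moreSpares (left x)  = left (right x)
    moreSpares (right x) = right x

    moreSpares-injective : ∀ {k m b p q} → Injective _≡_ _≡_ (moreSpares {k} {m} {b} {p} {q})
    moreSpares-injective {x = left _}  {left _}  e = cong left (right-injective (left-injective e))
    moreSpares-injective {x = right _} {right _} e = cong right (right-injective e)

    -- The first pivot is `y`, where the sequence leaves, and the fresh vertex is the next pivot.
    -- The fan around `y` starts at `x` with full budgets.
    spine-embeds : ∀ i {t} → Directed M t → size t ≤ i → size t ≤ n → ∀ {x y} → Embeds t (spine u i x y) x y
    -- Three budgets bound the three moves: `k` spare vertices for keeping the edge, `m` path
    -- vertices for advancing around `p`, and the `i` spine steps left after `q` for changing the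
    -- pivot. Every move uses up a vertex of `t`, so budgets as large as its size suffice.
    fan-embeds : ∀ i k m {t} → Directed M t → size t ≤ k → size t ≤ m → size t ≤ suc i → size t ≤ n →
                 ∀ {b p q} → FanEmbeds i t k m b p q

    spine-embeds zero    {t} d t≤i t≤n = embeds-edge t≤i
    spine-embeds (suc i) {t} d t≤i t≤n {x} {y} = record
      { pos  = spot ∘ pos e
      ; inj  = inj e ∘ spot-injective
      ; real = λ { {h = h} (fx , fy , _ , gS , gF) xy → Real-ext t (λ z → spot-placed h (pos e z))
                     (real e gF gS refl refl xy (R-sym fx) (R-sym fy)) }
      }
      where
      e = fan-embeds i n n d t≤n t≤n t≤i t≤n {1F} {2F} {0F}
      spot : Region i (fan u n n 1F 2F 0F) → Spot (spine u (suc i) x y)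
      spot pivot      = fresh
      spot (beyond z) = below (left z)
      spot (within z) = below (right z)
      spot-injective : Injective _≡_ _≡_ spot
      spot-injective {pivot}    {pivot}    _ = refl
      spot-injective {beyond _} {beyond _} e = cong beyond (left-injective (below-injective e))
      spot-injective {within _} {within _} e = cong within (right-injective (below-injective e))
      spot-placed : ∀ (h : Spot (spine u (suc i) x y) → H) z →
                    placed (h fresh) (h ∘ below ∘ left) (h ∘ below ∘ right) z ≡ h (spot z)
      spot-placed h pivot      = refl
      spot-placed h (beyond _) = refl
      spot-placed h (within _) = refl

    fan-embeds i k zero {edge} d t≤k t≤m t≤i t≤n = record
      { pos = λ () ; inj = λ { {()} } ; real = λ _ _ _ _ bp _ _ → bp }
    fan-embeds i k (suc m) (light t<M) t≤k t≤m t≤i t≤n = record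
      { pos = within ∘ left ∘ pos e ; inj = inj e ∘ left-injective ∘ within-injective
      ; real = λ { (gW , _) _ _ _ bp _ _ → real e gW bp } }
      where e = light-spares k t<M
    -- C takes a spare vertex with its two light parts; `s` continues on the same edge with one
    -- spare fewer.
    fan-embeds i (suc k) (suc m) {node l r s} (stay l<M r<M d) (s≤s t≤k) t≤m t≤i t≤n {b} {p} {q} = record
      { pos  = glue (within (left (left fresh))) (within ∘ left ∘ left ∘ below ∘ left ∘ pos el)
                    (within ∘ left ∘ left ∘ below ∘ right ∘ pos er) (mapWithin more ∘ pos es)
      ; inj  = glue-injective _ _ _ _
                 (inj el ∘ left-injective ∘ below-injective ∘ left-injective ∘ left-injective ∘ within-injective)
                 (inj er ∘ right-injective ∘ below-injective ∘ left-injective ∘ left-injective ∘ within-injective)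
                 (inj es ∘ mapWithin-injective more moreSpares-injective)
                 (λ _ ()) (λ _ ()) (λ x → old (pos es x)) (λ _ _ ()) (λ _ y → old (pos es y) ∘ ≡.sym) (λ _ y → old (pos es y) ∘ ≡.sym)
      ; real = λ { {h = h} (((cb , cp , _ , gl , gr) , gW) , g) gS e2 e0 bp bq pq →
                   real el gl (R-sym cb) , real er gr cp ,
                   Real-ext s (λ x → placed-mapWithin more (pos es x)) (real es {h = h ∘ more} (gW , g) gS e2 e0 bp bq pq) }
      }
      where
      more = moreSpares {k} {m} {b} {p} {q}
      s≤ : ∀ {j} → size (node l r s) ≤ j → size s ≤ j
      s≤ = ℕₚ.≤-trans (ℕₚ.≤-trans (ℕₚ.m≤n+m (size s) (size l + size r)) (ℕₚ.n≤1+n _))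
      el = embeds-u l 1F 0F l<M
      er = embeds-u r 0F 2F r<M
      es = fan-embeds i k (suc m) d (ℕₚ.≤-trans (ℕₚ.m≤n+m (size s) (size l + size r)) t≤k) (s≤ t≤m) (s≤ t≤i) (s≤ t≤n) {b} {p} {q}
      old : ∀ {y : Spot (new b p p (u 1F 0F ∥ u 0F 2F))} (z : Region i (fan u k (suc m) b p q)) → mapWithin more z ≢ within (left (left y))
      old = mapWithin≢ more (λ { (left _) () ; (right _) () })
    -- C becomes the next vertex of the path around the same pivot `p`, where a new supply of `n`
    -- spares is available.
    fan-embeds i k (suc m) {node l r s} (go l<M (inj₁ d) s<M) t≤k (s≤s t≤m) t≤i t≤n = record
      { pos  = glue (within (right (right fresh))) (within ∘ right ∘ right ∘ below ∘ left ∘ pos el)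
                    (mapWithin (right ∘ right ∘ below ∘ right) ∘ pos er) (within ∘ left ∘ pos es)
      ; inj  = glue-injective _ _ _ _
                 (inj el ∘ left-injective ∘ below-injective ∘ right-injective ∘ right-injective ∘ within-injective)
                 (inj er ∘ mapWithin-injective _ (right-injective ∘ below-injective ∘ right-injective ∘ right-injective))
                 (inj es ∘ left-injective ∘ within-injective)
                 (λ _ ()) (λ x → mapWithin≢ _ (λ _ ()) (pos er x)) (λ _ ())
                 (λ _ y → mapWithin≢ _ (λ _ ()) (pos er y) ∘ ≡.sym) (λ _ _ ()) (λ x _ → mapWithin≢ _ (λ _ ()) (pos er x))
      ; real = λ { (gW , _ , cb , cp , cq , gl , gF) gS e2 e0 bp bq pq →
                   real el gl (R-sym cb) ,
                   Real-ext r (λ x → placed-mapWithin _ (pos er x)) (real er gF gS e2 e0 cp cq pq) ,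
                   real es gW bp }
      }
      where
      r≤ : size r ≤ size l + size r + size s
      r≤ = ℕₚ.m≤n⇒m≤n+o (size s) (ℕₚ.m≤n+m (size r) (size l))
      r≤′ : ∀ {j} → size (node l r s) ≤ j → size r ≤ j
      r≤′ = ℕₚ.≤-trans (ℕₚ.≤-trans r≤ (ℕₚ.n≤1+n _))
      el = embeds-u l 1F 0F l<M
      er = fan-embeds i n m d (r≤′ t≤n) (ℕₚ.≤-trans r≤ t≤m) (r≤′ t≤i) (r≤′ t≤n) {0F} {2F} {3F}
      es = light-spares k s<M
    -- The sequence will leave C B at C, so C is the next pivot `q`, adjacent to `b` wherever the
    -- path has come to. The heavy part continues beyond, on the spine edge `p q`, hence flipped.
    fan-embeds i k (suc m) {node l r s} (go l<M (inj₂ d) s<M) t≤k t≤m (s≤s t≤i) t≤n {b} {p} {q} = record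
      { pos  = glue pivot (within ∘ right ∘ left ∘ pos el) (beyond ∘ pos er) (within ∘ left ∘ pos es)
      ; inj  = glue-injective _ _ _ _
                 (inj el ∘ left-injective ∘ right-injective ∘ within-injective)
                 (inj er ∘ beyond-injective)
                 (inj es ∘ left-injective ∘ within-injective)
                 (λ _ ()) (λ _ ()) (λ _ ()) (λ _ _ ()) (λ _ _ ()) (λ _ _ ())
      ; real = λ { (gW , gu , _) gS e2 e0 bp bq pq →
                   real el gu bq ,
                   subst₂ (λ a b → Real r a b _) e0 e2 (real er gS (R-sym (subst₂ R (≡.sym e2) (≡.sym e0) pq))) ,
                   real es gW bp }
      }
      where
      r≤ : size r ≤ size l + size r + size s
      r≤ = ℕₚ.m≤n⇒m≤n+o (size s) (ℕₚ.m≤n+m (size r) (size l))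
      el = embeds-u l b q l<M
      flip≤ : ∀ {j} → size r ≤ j → size (flip r) ≤ j
      flip≤ = subst (_≤ _) (≡.sym (size-flip r))
      er = embeds-flip (spine-embeds i d (flip≤ (ℕₚ.≤-trans r≤ t≤i)) (flip≤ (ℕₚ.≤-trans (ℕₚ.≤-trans r≤ (ℕₚ.n≤1+n _)) t≤n)) {2F} {0F})
      es = light-spares k s<M

  -- At level d + 1 the threshold for light parts is `2 ^ d`, so these go into level d by induction.
  -- The two spines answer the two outcomes of `directed`.
  universal-embeds : ∀ n d → 2 ^ d ≤ n → ∀ t x y → size t < 2 ^ d → Embeds t (Programs.universal n d x y) x y
  universal-embeds n zero    2^d≤n t x y t<1  = embeds-edge (ℕₚ.≤-pred t<1)
  universal-embeds n (suc d) 2^d≤n t x y t<2M = choose (directed M (ℕₚ.m^n>0 2 d) t (subst (λ k → size t < M + k) (ℕₚ.+-identityʳ M) t<2M))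
    where
    M = 2 ^ d
    open Level n (Programs.universal n d) M (universal-embeds n d (ℕₚ.≤-trans (ℕₚ.m≤m+n M _) 2^d≤n))
    t≤n : size t ≤ n
    t≤n = ℕₚ.≤-trans (ℕₚ.<⇒≤ t<2M) 2^d≤n
    choose : Directed M t ⊎ Directed M (flip t) → Embeds t (Programs.universal n (suc d) x y) x y
    choose (inj₁ dir) = record { pos = left ∘ pos e ; inj = inj e ∘ left-injective ; real = λ { (g , _) → real e g } }
      where e = spine-embeds n dir t≤n t≤n
    choose (inj₂ dir) = record { pos = right ∘ pos e ; inj = inj e ∘ right-injective ; real = λ { (_ , g) → real e g } }
      where
      flip≤n = subst (_≤ n) (≡.sym (size-flip t)) t≤n
      e = embeds-flip (spine-embeds n dir flip≤n flip≤n)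

-- Size of the host

module Cost (n : ℕ) (u : Slot → Slot → Prog) (c : ℕ) (cost-u : ∀ x y → cost (u x y) < c) where
  open Programs n
  open ℕₚ.≤-Reasoning

  private
    cost-u≤ : ∀ x y → cost (u x y) ≤ c
    cost-u≤ x y = ℕₚ.<⇒≤ (cost-u x y)

  -- The strict bound in `cost-u` pays for vertices: a new vertex together with one copy of `u`
  -- costs at most `c`. The same saving is used for fans and spines.
  cost-spares : ∀ k x y → cost (spares u k x y) ≤ (1 + 2 * k) * c
  cost-spares zero    x y = ℕₚ.≤-trans (cost-u≤ x y) (ℕₚ.≤-reflexive (≡.sym (ℕₚ.*-identityˡ c)))
  cost-spares (suc k) x y = begin
    suc (cost (u 1F 0F)) + cost (u 0F 2F) + cost (spares u k x y) ≤⟨ ℕₚ.+-mono-≤ (ℕₚ.+-mono-≤ (cost-u 1F 0F) (cost-u≤ 0F 2F)) (cost-spares k x y) ⟩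
    c + c + (1 + 2 * k) * c                                       ≡⟨ lem k c ⟩
    (1 + 2 * suc k) * c                                           ∎
    where
    lem : ∀ k c → c + c + (1 + 2 * k) * c ≡ (1 + 2 * suc k) * c
    lem = solve-∀

  cost-fan : ∀ m b p q → cost (fan u n m b p q) ≤ m * ((3 + 2 * n) * c)
  cost-fan zero    b p q = z≤n
  cost-fan (suc m) b p q = begin
    cost (spares u n b p) + (cost (u b q) + (suc (cost (u 1F 0F)) + cost (fan u n m 0F 2F 3F)))
      ≤⟨ ℕₚ.+-mono-≤ (cost-spares n b p) (ℕₚ.+-mono-≤ (cost-u≤ b q) (ℕₚ.+-mono-≤ (cost-u 1F 0F) (cost-fan m 0F 2F 3F))) ⟩
    (1 + 2 * n) * c + (c + (c + m * ((3 + 2 * n) * c)))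
      ≡⟨ lem n m c ⟩
    suc m * ((3 + 2 * n) * c) ∎
    where
    lem : ∀ n m c → (1 + 2 * n) * c + (c + (c + m * ((3 + 2 * n) * c))) ≡ suc m * ((3 + 2 * n) * c)
    lem = solve-∀

  cost-spine : ∀ i x y → cost (spine u i x y) ≤ i * ((1 + n * (3 + 2 * n)) * c)
  cost-spine zero    x y = z≤n
  cost-spine (suc i) x y = begin
    suc (cost (spine u i 2F 0F) + cost (fan u n n 1F 2F 0F))
      ≤⟨ ℕₚ.+-mono-≤ (ℕₚ.≤-trans (s≤s z≤n) (cost-u 0F 0F)) (ℕₚ.+-mono-≤ (cost-spine i 2F 0F) (cost-fan n 1F 2F 0F)) ⟩
    c + (i * ((1 + n * (3 + 2 * n)) * c) + n * ((3 + 2 * n) * c))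
      ≡⟨ lem n i c ⟩
    suc i * ((1 + n * (3 + 2 * n)) * c) ∎
    where
    lem : ∀ n i c → c + (i * ((1 + n * (3 + 2 * n)) * c) + n * ((3 + 2 * n) * c)) ≡ suc i * ((1 + n * (3 + 2 * n)) * c)
    lem = solve-∀

cost-universal : ∀ n → 4 ≤ n → ∀ d x y → cost (Programs.universal n d x y) < (8 * n ^ 3) ^ d
cost-universal n 4≤n zero    x y = s≤s z≤n
cost-universal n 4≤n (suc d) x y = begin-strict
  cost (spine u n x y) + cost (spine u n y x) ≤⟨ ℕₚ.+-mono-≤ (cost-spine n x y) (cost-spine n y x) ⟩
  -- The extra `c` keeps the bound strict for the next level.
  A + A                                       <⟨ ℕₚ.m<m+n (A + A) c>0 ⟩
  A + A + c                                   ≡⟨ lem₁ n c ⟩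
  (4 * n ^ 3 + (6 * (n * n) + 2 * n + 1)) * c ≤⟨ ℕₚ.*-monoˡ-≤ c (ℕₚ.+-monoʳ-≤ (4 * n ^ 3) cubic) ⟩
  (4 * n ^ 3 + 4 * n ^ 3) * c                 ≡⟨ lem₂ n c ⟩
  8 * n ^ 3 * c                               ∎
  where
  open ℕₚ.≤-Reasoning
  open Programs n
  u = universal d
  c = (8 * n ^ 3) ^ d
  open Cost n u c (cost-universal n 4≤n d)
  A = n * ((1 + n * (3 + 2 * n)) * c)
  c>0 : 0 < c
  c>0 = ℕₚ.≤-trans (s≤s z≤n) (cost-universal n 4≤n d x y)
  1≤n : 1 ≤ n
  1≤n = ℕₚ.≤-trans (s≤s z≤n) 4≤n
  lem₁ : ∀ n c → n * ((1 + n * (3 + 2 * n)) * c) + n * ((1 + n * (3 + 2 * n)) * c) + c ≡ (4 * (n * (n * (n * 1))) + (6 * (n * n) + 2 * n + 1)) * c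
  lem₁ = solve-∀
  lem₂ : ∀ n c → (4 * (n * (n * (n * 1))) + 4 * (n * (n * (n * 1)))) * c ≡ 8 * (n * (n * (n * 1))) * c
  lem₂ = solve-∀
  lem₃ : ∀ n → 6 * (n * n) + 2 * (n * n) + (n * n) + 7 * (n * n) ≡ 4 * (4 * (n * n))
  lem₃ = solve-∀
  lem₄ : ∀ n → 4 * (n * (n * n)) ≡ 4 * (n * (n * (n * 1)))
  lem₄ = solve-∀
  n≤n² : n ≤ n * n
  n≤n² = ℕₚ.≤-trans (ℕₚ.≤-reflexive (≡.sym (ℕₚ.*-identityʳ n))) (ℕₚ.*-monoʳ-≤ n 1≤n)
  -- The left side is at most 9n², rounded up to 16n² = 4 · 4n² so that `4 ≤ n` gives 4n³.
  cubic : 6 * (n * n) + 2 * n + 1 ≤ 4 * n ^ 3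
  cubic = begin
    6 * (n * n) + 2 * n + 1                             ≤⟨ ℕₚ.+-mono-≤ (ℕₚ.+-monoʳ-≤ (6 * (n * n)) (ℕₚ.*-monoʳ-≤ 2 n≤n²)) (ℕₚ.≤-trans 1≤n n≤n²) ⟩
    6 * (n * n) + 2 * (n * n) + (n * n)                 ≤⟨ ℕₚ.m≤m+n _ (7 * (n * n)) ⟩
    6 * (n * n) + 2 * (n * n) + (n * n) + 7 * (n * n)   ≡⟨ lem₃ n ⟩
    4 * (4 * (n * n))                                   ≤⟨ ℕₚ.*-monoʳ-≤ 4 (ℕₚ.*-monoˡ-≤ (n * n) 4≤n) ⟩
    4 * (n * (n * n))                                   ≡⟨ lem₄ n ⟩
    4 * n ^ 3                                           ∎

-- The witnesses for the real exponent are s = L = ⌊log₂ n⌋ and t = 1.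
powLogBound : ∀ {N n} L → 2 ^ L ≤ n → N ≤ 2 ^ (20 * (L * L)) → PowLogBound N n
powLogBound {N} {n} L 2^L≤n N≤ p q 1≤q 2^p<N^q =
  L , 1 , s≤s z≤n , ℕₚ.≤-trans 2^L≤n (ℕₚ.≤-reflexive (≡.sym (ℕₚ.*-identityʳ n))) ,
  subst (_< 20 * (L * L) * q) (≡.sym (ℕₚ.*-identityʳ p))
    (ℕₚ.≰⇒> λ le → ℕₚ.<⇒≱ 2^p<2^ (ℕₚ.^-monoʳ-≤ 2 le))
  where
  open ℕₚ.≤-Reasoning
  2^p<2^ : 2 ^ p < 2 ^ (20 * (L * L) * q)
  2^p<2^ = begin-strict
    2 ^ p                      <⟨ 2^p<N^q ⟩
    N ^ q                      ≤⟨ ℕₚ.^-monoˡ-≤ q N≤ ⟩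
    (2 ^ (20 * (L * L))) ^ q   ≡⟨ ℕₚ.^-*-assoc 2 (20 * (L * L)) q ⟩
    2 ^ (20 * (L * L) * q)     ∎

floor-log : ∀ n → 1 ≤ n → ∃ λ L → 2 ^ L ≤ n × n < 2 ^ suc L
floor-log (suc zero)    _ = 0 , s≤s z≤n , s≤s (s≤s z≤n)
floor-log (suc (suc n)) _ with floor-log (suc n) (s≤s z≤n)
... | L , lo , hi with suc (suc n) <? 2 ^ suc L
...   | yes lt = L , ℕₚ.m≤n⇒m≤1+n lo , lt
...   | no ≮ = suc L , ℕₚ.≮⇒≥ ≮ , ℕₚ.≤-<-trans hi (ℕₚ.^-monoʳ-< 2 (s≤s (s≤s z≤n)) (ℕₚ.n<1+n (suc L)))

-- Here `suc j` is the floor of the logarithm and the depth is one more. The two extra vertices are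
-- the starting point and the second end of the base edge.
cost-bound : ∀ j x y → suc (suc (cost (Programs.universal (2 ^ (2 + j)) (2 + j) x y))) ≤ 2 ^ (20 * (suc j * suc j))
cost-bound j x y = begin
  suc (suc (cost (Programs.universal n d x y))) ≤⟨ s≤s (cost-universal n (ℕₚ.^-monoʳ-≤ 2 (ℕₚ.m≤m+n 2 j)) d x y) ⟩
  suc ((8 * n ^ 3) ^ d)                         ≡⟨ cong (λ k → suc ((8 * k) ^ d)) (ℕₚ.^-*-assoc 2 d 3) ⟩
  suc ((8 * 2 ^ (d * 3)) ^ d)                   ≡⟨ cong (λ k → suc (k ^ d)) (≡.sym (ℕₚ.^-distribˡ-+-* 2 3 (d * 3))) ⟩
  suc ((2 ^ (3 + d * 3)) ^ d)                   ≡⟨ cong suc (ℕₚ.^-*-assoc 2 (3 + d * 3) d) ⟩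
  suc (2 ^ e)                                   ≤⟨ ℕₚ.+-monoˡ-≤ (2 ^ e) (ℕₚ.m^n>0 2 e) ⟩
  2 ^ e + 2 ^ e                                 ≡⟨ cong (2 ^ e +_) (≡.sym (ℕₚ.+-identityʳ (2 ^ e))) ⟩
  -- The added term is exactly the gap between `suc e` = 3j² + 15j + 19 and 20(j + 1)².
  2 ^ suc e                                     ≤⟨ ℕₚ.^-monoʳ-≤ 2 (ℕₚ.m≤m+n (suc e) (17 * (j * j) + 25 * j + 1)) ⟩
  2 ^ (suc e + (17 * (j * j) + 25 * j + 1))     ≡⟨ cong (2 ^_) (lem j) ⟩
  2 ^ (20 * (suc j * suc j))                    ∎
  where
  open ℕₚ.≤-Reasoning
  d = 2 + j
  n = 2 ^ d
  e = (3 + d * 3) * d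
  lem : ∀ j → suc ((3 + (2 + j) * 3) * (2 + j)) + (17 * (j * j) + 25 * j + 1) ≡ 20 * (suc j * suc j)
  lem = solve-∀

-- Graphs of treewidth 2 in 2-trees

data Vertex (t : 2Tree) : Set where
  rootᴬ rootᴮ : Vertex t
  at          : Pos t → Vertex t

at-injective : ∀ {t} → Injective _≡_ _≡_ (at {t})
at-injective refl = refl

-- Every edge of the 2-tree is the base edge of exactly one leaf of the ternary tree.
data Link : 2Tree → Set where
  link : Link edge
  viaˡ : ∀ {l r s} → Link l → Link (node l r s)
  viaʳ : ∀ {l r s} → Link r → Link (node l r s)
  viaˢ : ∀ {l r s} → Link s → Link (node l r s)

module _ {l r s : 2Tree} where
  upˡ : Vertex l → Vertex (node l r s)
  upˡ rootᴬ  = rootᴬ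
  upˡ rootᴮ  = at top
  upˡ (at x) = at (inˡ x)

  upʳ : Vertex r → Vertex (node l r s)
  upʳ rootᴬ  = at top
  upʳ rootᴮ  = rootᴮ
  upʳ (at x) = at (inʳ x)

  upˢ : Vertex s → Vertex (node l r s)
  upˢ rootᴬ  = rootᴬ
  upˢ rootᴮ  = rootᴮ
  upˢ (at x) = at (inˢ x)

src tgt : ∀ {t} → Link t → Vertex t
src link     = rootᴬ
src (viaˡ e) = upˡ (src e)
src (viaʳ e) = upʳ (src e)
src (viaˢ e) = upˢ (src e)
tgt link     = rootᴮ
tgt (viaˡ e) = upˡ (tgt e)
tgt (viaʳ e) = upʳ (tgt e)
tgt (viaˢ e) = upˢ (tgt e)

-- The part `s` keeps the base edge, so descending through such parts ends at its leaf.
rootLink : ∀ t → ∃ λ (e : Link t) → src e ≡ rootᴬ × tgt e ≡ rootᴮ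
rootLink edge = link , refl , refl
rootLink (node l r s) = let e , a , b = rootLink s in viaˢ e , cong upˢ a , cong upˢ b

EndOf : ∀ {t} → Link t → Vertex t → Set
EndOf e v = v ≡ src e ⊎ v ≡ tgt e

linkAt : ∀ {t} (v : Vertex t) → ∃ λ e → EndOf e v
linkAt {t} rootᴬ = let e , a , b = rootLink t in e , inj₁ (≡.sym a)
linkAt {t} rootᴮ = let e , a , b = rootLink t in e , inj₂ (≡.sym b)
linkAt {node l r s} (at top) = let e , a , b = rootLink l in viaˡ e , inj₂ (≡.sym (cong upˡ b))
linkAt (at (inˡ x)) = let e , o = linkAt (at x) in viaˡ e , Sum.map (cong upˡ) (cong upˡ) o
linkAt (at (inʳ x)) = let e , o = linkAt (at x) in viaʳ e , Sum.map (cong upʳ) (cong upʳ) o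
linkAt (at (inˢ x)) = let e , o = linkAt (at x) in viaˢ e , Sum.map (cong upˢ) (cong upˢ) o

-- Stacks a new vertex on the chosen edge, which itself survives as the third part of the new node.
insert : ∀ {t} → Link t → 2Tree
insert link                  = node edge edge edge
insert {node l r s} (viaˡ e) = node (insert e) r s
insert {node l r s} (viaʳ e) = node l (insert e) s
insert {node l r s} (viaˢ e) = node l r (insert e)

size-insert : ∀ {t} (e : Link t) → size (insert e) ≡ suc (size t)
size-insert link = refl
size-insert {node l r s} (viaˡ e) = cong (λ k → suc (k + size r + size s)) (size-insert e)
size-insert {node l r s} (viaʳ e) = cong suc (≡.trans (cong (λ k → size l + k + size s) (size-insert e)) (cong (_+ size s) (ℕₚ.+-suc (size l) (size r))))
size-insert {node l r s} (viaˢ e) = cong suc (≡.trans (cong (size l + size r +_) (size-insert e)) (ℕₚ.+-suc (size l + size r) (size s)))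

newPos : ∀ {t} (e : Link t) → Pos (insert e)
newPos link     = top
newPos (viaˡ e) = inˡ (newPos e)
newPos (viaʳ e) = inʳ (newPos e)
newPos (viaˢ e) = inˢ (newPos e)

oldPos : ∀ {t} (e : Link t) → Pos t → Pos (insert e)
oldPos (viaˡ e) top     = top
oldPos (viaˡ e) (inˡ x) = inˡ (oldPos e x)
oldPos (viaˡ e) (inʳ x) = inʳ x
oldPos (viaˡ e) (inˢ x) = inˢ x
oldPos (viaʳ e) top     = top
oldPos (viaʳ e) (inˡ x) = inˡ x
oldPos (viaʳ e) (inʳ x) = inʳ (oldPos e x)
oldPos (viaʳ e) (inˢ x) = inˢ x
oldPos (viaˢ e) top     = top
oldPos (viaˢ e) (inˡ x) = inˡ x
oldPos (viaˢ e) (inʳ x) = inʳ x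
oldPos (viaˢ e) (inˢ x) = inˢ (oldPos e x)

old : ∀ {t} (e : Link t) → Vertex t → Vertex (insert e)
old e rootᴬ  = rootᴬ
old e rootᴮ  = rootᴮ
old e (at x) = at (oldPos e x)

oldPos-injective : ∀ {t} (e : Link t) → Injective _≡_ _≡_ (oldPos e)
oldPos-injective (viaˡ e) {top}   {top}   _  = refl
oldPos-injective (viaˡ e) {inˡ _} {inˡ _} eq = cong inˡ (oldPos-injective e (inˡ-injective eq))
oldPos-injective (viaˡ e) {inʳ _} {inʳ _} eq = cong inʳ (inʳ-injective eq)
oldPos-injective (viaˡ e) {inˢ _} {inˢ _} eq = cong inˢ (inˢ-injective eq)
oldPos-injective (viaʳ e) {top}   {top}   _  = refl
oldPos-injective (viaʳ e) {inˡ _} {inˡ _} eq = cong inˡ (inˡ-injective eq)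
oldPos-injective (viaʳ e) {inʳ _} {inʳ _} eq = cong inʳ (oldPos-injective e (inʳ-injective eq))
oldPos-injective (viaʳ e) {inˢ _} {inˢ _} eq = cong inˢ (inˢ-injective eq)
oldPos-injective (viaˢ e) {top}   {top}   _  = refl
oldPos-injective (viaˢ e) {inˡ _} {inˡ _} eq = cong inˡ (inˡ-injective eq)
oldPos-injective (viaˢ e) {inʳ _} {inʳ _} eq = cong inʳ (inʳ-injective eq)
oldPos-injective (viaˢ e) {inˢ _} {inˢ _} eq = cong inˢ (oldPos-injective e (inˢ-injective eq))

oldPos≢newPos : ∀ {t} (e : Link t) x → oldPos e x ≢ newPos e
oldPos≢newPos (viaˡ e) (inˡ x) eq = oldPos≢newPos e x (inˡ-injective eq)
oldPos≢newPos (viaʳ e) (inʳ x) eq = oldPos≢newPos e x (inʳ-injective eq)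
oldPos≢newPos (viaˢ e) (inˢ x) eq = oldPos≢newPos e x (inˢ-injective eq)

old-injective : ∀ {t} (e : Link t) → Injective _≡_ _≡_ (old e)
old-injective e {rootᴬ} {rootᴬ} _  = refl
old-injective e {rootᴮ} {rootᴮ} _  = refl
old-injective e {at _}  {at _}  eq = cong at (oldPos-injective e (at-injective eq))

old≢new : ∀ {t} (e : Link t) v → old e v ≢ at (newPos e)
old≢new e (at x) eq = oldPos≢newPos e x (at-injective eq)

module _ {l r s : 2Tree} where
  old-upˡ : ∀ (e : Link l) v → old (viaˡ {l} {r} {s} e) (upˡ v) ≡ upˡ (old e v)
  old-upˡ e rootᴬ  = refl
  old-upˡ e rootᴮ  = refl
  old-upˡ e (at _) = refl

  old-upʳ : ∀ (e : Link r) v → old (viaʳ {l} {r} {s} e) (upʳ v) ≡ upʳ (old e v)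
  old-upʳ e rootᴬ  = refl
  old-upʳ e rootᴮ  = refl
  old-upʳ e (at _) = refl

  old-upˢ : ∀ (e : Link s) v → old (viaˢ {l} {r} {s} e) (upˢ v) ≡ upˢ (old e v)
  old-upˢ e rootᴬ  = refl
  old-upˢ e rootᴮ  = refl
  old-upˢ e (at _) = refl

Linked : ∀ t → Vertex t → Vertex t → Set
Linked t x y = ∃ λ (e : Link t) → x ≡ src e × y ≡ tgt e

module _ {l r s : 2Tree} where
  linkedˡ : ∀ {x y x′ y′} → x′ ≡ upˡ x → y′ ≡ upˡ y → Linked l x y → Linked (node l r s) x′ y′
  linkedˡ p q (e , a , b) = viaˡ e , ≡.trans p (cong upˡ a) , ≡.trans q (cong upˡ b)
  linkedʳ : ∀ {x y x′ y′} → x′ ≡ upʳ x → y′ ≡ upʳ y → Linked r x y → Linked (node l r s) x′ y′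
  linkedʳ p q (e , a , b) = viaʳ e , ≡.trans p (cong upʳ a) , ≡.trans q (cong upʳ b)
  linkedˢ : ∀ {x y x′ y′} → x′ ≡ upˢ x → y′ ≡ upˢ y → Linked s x y → Linked (node l r s) x′ y′
  linkedˢ p q (e , a , b) = viaˢ e , ≡.trans p (cong upˢ a) , ≡.trans q (cong upˢ b)

old-linked : ∀ {t} (e e′ : Link t) → Linked (insert e) (old e (src e′)) (old e (tgt e′))
old-linked link     link      = viaˢ link , refl , refl
old-linked (viaˡ e) (viaˡ e′) = linkedˡ (old-upˡ e _) (old-upˡ e _) (old-linked e e′)
old-linked (viaʳ e) (viaʳ e′) = linkedʳ (old-upʳ e _) (old-upʳ e _) (old-linked e e′)
old-linked (viaˢ e) (viaˢ e′) = linkedˢ (old-upˢ e _) (old-upˢ e _) (old-linked e e′)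
old-linked (viaˡ e) (viaʳ e′) = linkedʳ (lem (src e′)) (lem (tgt e′)) (e′ , refl , refl)
  where lem : ∀ v → old (viaˡ e) (upʳ v) ≡ upʳ v
        lem rootᴬ = refl
        lem rootᴮ = refl
        lem (at _) = refl
old-linked (viaˡ e) (viaˢ e′) = linkedˢ (lem (src e′)) (lem (tgt e′)) (e′ , refl , refl)
  where lem : ∀ v → old (viaˡ e) (upˢ v) ≡ upˢ v
        lem rootᴬ = refl
        lem rootᴮ = refl
        lem (at _) = refl
old-linked (viaʳ e) (viaˡ e′) = linkedˡ (lem (src e′)) (lem (tgt e′)) (e′ , refl , refl)
  where lem : ∀ v → old (viaʳ e) (upˡ v) ≡ upˡ v
        lem rootᴬ = refl
        lem rootᴮ = refl
        lem (at _) = refl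
old-linked (viaʳ e) (viaˢ e′) = linkedˢ (lem (src e′)) (lem (tgt e′)) (e′ , refl , refl)
  where lem : ∀ v → old (viaʳ e) (upˢ v) ≡ upˢ v
        lem rootᴬ = refl
        lem rootᴮ = refl
        lem (at _) = refl
old-linked (viaˢ e) (viaˡ e′) = linkedˡ (lem (src e′)) (lem (tgt e′)) (e′ , refl , refl)
  where lem : ∀ v → old (viaˢ e) (upˡ v) ≡ upˡ v
        lem rootᴬ = refl
        lem rootᴮ = refl
        lem (at _) = refl
old-linked (viaˢ e) (viaʳ e′) = linkedʳ (lem (src e′)) (lem (tgt e′)) (e′ , refl , refl)
  where lem : ∀ v → old (viaˢ e) (upʳ v) ≡ upʳ v
        lem rootᴬ = refl
        lem rootᴮ = refl
        lem (at _) = refl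

src-linked : ∀ {t} (e : Link t) → Linked (insert e) (old e (src e)) (at (newPos e))
src-linked link     = viaˡ link , refl , refl
src-linked (viaˡ e) = linkedˡ (old-upˡ e _) refl (src-linked e)
src-linked (viaʳ e) = linkedʳ (old-upʳ e _) refl (src-linked e)
src-linked (viaˢ e) = linkedˢ (old-upˢ e _) refl (src-linked e)

tgt-linked : ∀ {t} (e : Link t) → Linked (insert e) (at (newPos e)) (old e (tgt e))
tgt-linked link     = viaʳ link , refl , refl
tgt-linked (viaˡ e) = linkedˡ refl (old-upˡ e _) (tgt-linked e)
tgt-linked (viaʳ e) = linkedʳ refl (old-upʳ e _) (tgt-linked e)
tgt-linked (viaˢ e) = linkedˢ refl (old-upˢ e _) (tgt-linked e)

Joined : ∀ t → Vertex t → Vertex t → Set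
Joined t x y = Linked t x y ⊎ Linked t y x

old-joined : ∀ {t} (e : Link t) {x y} → Joined t x y → Joined (insert e) (old e x) (old e y)
old-joined e (inj₁ (e′ , refl , refl)) = inj₁ (old-linked e e′)
old-joined e (inj₂ (e′ , refl , refl)) = inj₂ (old-linked e e′)

new-joined : ∀ {t} (e : Link t) {x} → EndOf e x → Joined (insert e) (at (newPos e)) (old e x)
new-joined e (inj₁ refl) = inj₂ (src-linked e)
new-joined e (inj₂ refl) = inj₁ (tgt-linked e)

-- Subsets as duplicate-free lists

elements : ∀ {n} → Subset n → List (Fin n)
elements []          = []
elements (true ∷ p)  = zero ∷ map suc (elements p)
elements (false ∷ p) = map suc (elements p)

length-elements : ∀ {n} (p : Subset n) → length (elements p) ≡ ∣ p ∣
length-elements []          = refl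
length-elements (true ∷ p)  = cong suc (≡.trans (length-map suc (elements p)) (length-elements p))
length-elements (false ∷ p) = ≡.trans (length-map suc (elements p)) (length-elements p)

∈-elements⁺ : ∀ {n} {p : Subset n} {v} → v ∈ p → v ∈ₗ elements p
∈-elements⁺ here                      = here refl
∈-elements⁺ {p = true ∷ p}  (there v∈) = there (∈-map⁺ suc (∈-elements⁺ v∈))
∈-elements⁺ {p = false ∷ p} (there v∈) = ∈-map⁺ suc (∈-elements⁺ v∈)

∈-elements⁻ : ∀ {n} (p : Subset n) {v} → v ∈ₗ elements p → v ∈ p
∈-elements⁻ (true ∷ p)  (here refl) = here
∈-elements⁻ (true ∷ p)  (there v∈) with ∈-map⁻ suc v∈
... | w , w∈ , refl = there (∈-elements⁻ p w∈)
∈-elements⁻ (false ∷ p) v∈ with ∈-map⁻ suc v∈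
... | w , w∈ , refl = there (∈-elements⁻ p w∈)

elements-unique : ∀ {n} (p : Subset n) → Unique (elements p)
elements-unique []          = []
elements-unique (true ∷ p)  = All.tabulate (λ v∈ 0≡v → case (∈-map⁻ suc v∈) 0≡v) ∷ Unique.map⁺ suc-injective (elements-unique p)
  where
  case : ∀ {n} {xs : List (Fin n)} {v} → (∃ λ w → w ∈ₗ xs × v ≡ suc w) → ¬ zero ≡ v
  case (_ , _ , refl) ()
elements-unique (false ∷ p) = Unique.map⁺ suc-injective (elements-unique p)

lookup-injective : ∀ {A : Set} {xs : List A} → Unique xs → Injective _≡_ _≡_ (List.lookup xs)
lookup-injective (x≢ ∷ xs!) {zero}  {zero}  eq = refl
lookup-injective {xs = _ ∷ xs} (x≢ ∷ xs!) {zero}  {suc j} eq = ⊥-elim (All.lookup x≢ (∈-lookup {xs = xs} j) eq)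
lookup-injective {xs = _ ∷ xs} (x≢ ∷ xs!) {suc i} {zero}  eq = ⊥-elim (All.lookup x≢ (∈-lookup {xs = xs} i) (≡.sym eq))
lookup-injective (x≢ ∷ xs!) {suc i} {suc j} eq = cong suc (lookup-injective xs! eq)

unique-length : ∀ {n} {xs : List (Fin n)} → Unique xs → length xs ≤ n
unique-length xs! = injective⇒≤ (lookup-injective xs!)

filter-length : ∀ {A : Set} {P : A → Set} (P? : ∀ x → Dec (P x)) xs →
                length (filter P? xs) + length (filter (¬? ∘ P?) xs) ≡ length xs
filter-length P? [] = refl
filter-length P? (x ∷ xs) with P? x
... | yes _ = cong suc (filter-length P? xs)
... | no  _ = ≡.trans (ℕₚ.+-suc _ _) (cong suc (filter-length P? xs))

-- Building a 2-tree vertex by vertex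

module _ {n : ℕ} where

  _∈?_ : (v : Fin n) (vs : List (Fin n)) → Dec (v ∈ₗ vs)
  _∈?_ = mem? _≟_

  -- The non-root vertices of the 2-tree correspond to `vs`: an injection between sets of equal
  -- size. Outside `vs` the values of `vertex` are arbitrary.
  record Filling (vs : List (Fin n)) : Set where
    field
      2tree   : 2Tree
      size≡   : size 2tree ≡ length vs
      unique  : Unique vs
      vertex  : Fin n → Vertex 2tree
      isPos   : ∀ {v} → v ∈ₗ vs → ∃ λ x → vertex v ≡ at x
      inj     : ∀ {u v} → u ∈ₗ vs → v ∈ₗ vs → vertex u ≡ vertex v → u ≡ v

    Adjacent : Fin n → Fin n → Set
    Adjacent u v = Joined 2tree (vertex u) (vertex v)

    Clique : List (Fin n) → Set
    Clique xs = ∀ {u v} → u ∈ₗ xs → v ∈ₗ xs → u ≢ v → Adjacent u v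
  open Filling

  empty : Filling []
  empty = record { 2tree = edge ; size≡ = refl ; unique = [] ; vertex = λ _ → rootᴬ ; isPos = λ () ; inj = λ () }

  record _≼_ {vs ws} (F : Filling vs) (G : Filling ws) : Set where
    field
      keeps    : ∀ {v} → v ∈ₗ vs → v ∈ₗ ws
      adjacent : ∀ {u v} → u ∈ₗ vs → v ∈ₗ vs → Adjacent F u v → Adjacent G u v
  open _≼_

  ≼-trans : ∀ {vs ws zs} {F : Filling vs} {G : Filling ws} {K : Filling zs} → F ≼ G → G ≼ K → F ≼ K
  ≼-trans e e′ = record { keeps = keeps e′ ∘ keeps e
                        ; adjacent = λ u∈ v∈ → adjacent e′ (keeps e u∈) (keeps e v∈) ∘ adjacent e u∈ v∈ }

  module _ {vs} (F : Filling vs) {w} (w∉ : w ∉ₗ vs) (e : Link (2tree F)) where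
    private
      vertex′ : Fin n → Vertex (insert e)
      vertex′ v with v ≟ w
      ... | yes _ = at (newPos e)
      ... | no  _ = old e (vertex F v)

      vertex-w : vertex′ w ≡ at (newPos e)
      vertex-w with w ≟ w
      ... | yes _ = refl
      ... | no ≢ = ⊥-elim (≢ refl)

      vertex-old : ∀ {v} → v ∈ₗ vs → vertex′ v ≡ old e (vertex F v)
      vertex-old {v} v∈ with v ≟ w
      ... | yes refl = ⊥-elim (w∉ v∈)
      ... | no _ = refl

      isPos′ : ∀ {v} → v ∈ₗ (w ∷ vs) → ∃ λ x → vertex′ v ≡ at x
      isPos′ (here refl) = newPos e , vertex-w
      isPos′ (there v∈)  = let x , eq = isPos F v∈ in oldPos e x , ≡.trans (vertex-old v∈) (cong (old e) eq)

      inj′ : ∀ {u v} → u ∈ₗ (w ∷ vs) → v ∈ₗ (w ∷ vs) → vertex′ u ≡ vertex′ v → u ≡ v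
      inj′ (here refl) (here refl) eq = refl
      inj′ (here refl) (there v∈)  eq = ⊥-elim (old≢new e _ (≡.trans (≡.sym (vertex-old v∈)) (≡.trans (≡.sym eq) vertex-w)))
      inj′ (there u∈)  (here refl) eq = ⊥-elim (old≢new e _ (≡.trans (≡.sym (vertex-old u∈)) (≡.trans eq vertex-w)))
      inj′ (there u∈)  (there v∈)  eq = inj F u∈ v∈ (old-injective e (≡.trans (≡.sym (vertex-old u∈)) (≡.trans eq (vertex-old v∈))))

    insertVertex : Filling (w ∷ vs)
    insertVertex = record
      { 2tree = insert e ; size≡ = ≡.trans (size-insert e) (cong suc (size≡ F))
      ; unique = All.tabulate (λ v∈ w≡v → w∉ (subst (_∈ₗ vs) (≡.sym w≡v) v∈)) ∷ unique F
      ; vertex = vertex′ ; isPos = isPos′ ; inj = inj′ }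

    insertVertex-≼ : F ≼ insertVertex
    insertVertex-≼ = record { keeps = there ; adjacent = λ u∈ v∈ uv →
      subst₂ (Joined (insert e)) (≡.sym (vertex-old u∈)) (≡.sym (vertex-old v∈)) (old-joined e uv) }

    insertVertex-adjacent : ∀ {v} → v ∈ₗ vs → EndOf e (vertex F v) → Adjacent insertVertex w v
    insertVertex-adjacent v∈ o = subst₂ (Joined (insert e)) (≡.sym vertex-w) (≡.sym (vertex-old v∈)) (new-joined e o)

  -- Finds where to stack a new vertex that must be joined to all of `xs`. Two vertices of a clique
  -- are the ends of an edge; a single vertex lies on some edge, and for none the base edge will do.
  commonLink : ∀ {vs} (F : Filling vs) xs → length xs ≤ 2 → Clique F xs →
               ∃ λ e → ∀ {x} → x ∈ₗ xs → EndOf e (vertex F x)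
  commonLink F [] _ _ = proj₁ (rootLink (2tree F)) , λ ()
  commonLink F (x ∷ []) _ _ = let e , o = linkAt (vertex F x) in e , λ { (here refl) → o }
  commonLink F (x ∷ y ∷ []) _ c with x ≟ y
  ... | yes refl = let e , o = linkAt (vertex F x) in e , λ { (here refl) → o ; (there (here refl)) → o }
  ... | no x≢y with c (here refl) (there (here refl)) x≢y
  ...   | inj₁ (e , a , b) = e , λ { (here refl) → inj₁ a ; (there (here refl)) → inj₂ b }
  ...   | inj₂ (e , a , b) = e , λ { (here refl) → inj₂ b ; (there (here refl)) → inj₁ a }
  commonLink F (_ ∷ _ ∷ _ ∷ _) (s≤s (s≤s ()))

  record Completion {vs} (F : Filling vs) (xs ys : List (Fin n)) : Set where
    field
      {placed} : List (Fin n)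
      filling  : Filling placed
      extends  : F ≼ filling
      clique   : ∀ {u v} → u ∈ₗ xs ⊎ u ∈ₗ ys → v ∈ₗ xs ⊎ v ∈ₗ ys → u ≢ v → Adjacent filling u v
      adds     : ∀ {v} → v ∈ₗ ys → v ∈ₗ placed
      only     : ∀ {v} → v ∈ₗ placed → v ∈ₗ vs ⊎ v ∈ₗ ys
  open Completion

  -- Enlarges the clique `xs` to a whole bag. Each `y` is stacked on an edge through the vertices
  -- before it; there are at most two of these because the bag has at most three.
  complete : ∀ {vs} (F : Filling vs) xs ys → (∀ {x} → x ∈ₗ xs → x ∈ₗ vs) → Clique F xs →
             (∀ {y} → y ∈ₗ ys → y ∉ₗ vs) → Unique ys → length xs + length ys ≤ 3 → Completion F xs ys
  complete F xs [] xs⊆ c ys∉ ys! ≤3 = record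
    { filling = F ; extends = record { keeps = id ; adjacent = λ _ _ → id }
    ; clique = λ { (inj₁ u∈) (inj₁ v∈) → c u∈ v∈ } ; adds = λ () ; only = inj₁ }
  complete {vs} F xs (y ∷ ys) xs⊆ c ys∉ (y≢ ∷ ys!) ≤3 = record
    { filling = filling C ; extends = ≼-trans (insertVertex-≼ F y∉ e) (extends C)
    ; clique = λ u∈ v∈ → clique C (shift u∈) (shift v∈)
    ; adds = λ { (here refl) → keeps (extends C) (here refl) ; (there v∈) → adds C v∈ }
    ; only = λ v∈ → unshift (only C v∈) }
    where
    y∉ = ys∉ (here refl)
    xs≤2 : suc (length xs) + length ys ≤ 3
    xs≤2 = subst (_≤ 3) (ℕₚ.+-suc (length xs) (length ys)) ≤3
    common = commonLink F xs (ℕₚ.≤-pred (ℕₚ.≤-trans (ℕₚ.m≤m+n _ (length ys)) xs≤2)) c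
    e = proj₁ common
    F′ = insertVertex F y∉ e
    clique′ : Clique F′ (y ∷ xs)
    clique′ (here refl) (here refl) u≢v = ⊥-elim (u≢v refl)
    clique′ (here refl) (there v∈)  u≢v = insertVertex-adjacent F y∉ e (xs⊆ v∈) (proj₂ common v∈)
    clique′ (there u∈)  (here refl) u≢v = Sum.swap (insertVertex-adjacent F y∉ e (xs⊆ u∈) (proj₂ common u∈))
    clique′ (there u∈)  (there v∈)  u≢v = adjacent (insertVertex-≼ F y∉ e) (xs⊆ u∈) (xs⊆ v∈) (c u∈ v∈ u≢v)
    C = complete F′ (y ∷ xs) ys (λ { (here refl) → here refl ; (there x∈) → there (xs⊆ x∈) }) clique′
          (λ { z∈ (here refl) → All.lookup y≢ z∈ refl ; z∈ (there z∈vs) → ys∉ (there z∈) z∈vs }) ys! xs≤2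
    shift : ∀ {v} → v ∈ₗ xs ⊎ v ∈ₗ (y ∷ ys) → v ∈ₗ (y ∷ xs) ⊎ v ∈ₗ ys
    shift (inj₁ v∈)          = inj₁ (there v∈)
    shift (inj₂ (here refl)) = inj₁ (here refl)
    shift (inj₂ (there v∈))  = inj₂ v∈
    unshift : ∀ {v} → v ∈ₗ (y ∷ vs) ⊎ v ∈ₗ ys → v ∈ₗ vs ⊎ v ∈ₗ (y ∷ ys)
    unshift (inj₁ (here refl)) = inj₂ (here refl)
    unshift (inj₁ (there v∈))  = inj₁ v∈
    unshift (inj₂ v∈)          = inj₂ (there v∈)

-- Leaves of acyclic graphs

walk-start : ∀ {n} {G : Graph n} {P : Fin n → Set} {u v} → WalkIn G P u v → P u
walk-start (here p)     = p
walk-start (step p _ _) = p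

module _ {m} {T : Graph m} where

  -- The path grows at `visit 0`, with the older vertices shifted up; values of `visit` past `len`
  -- are arbitrary.
  record Path (A : List (Fin m)) (len : ℕ) : Set where
    field
      visit : ℕ → Fin m
      inj   : ∀ {i j} → i ≤ len → j ≤ len → visit i ≡ visit j → i ≡ j
      adjac : ∀ {i} → i < len → Adj T (visit i) (visit (suc i))
      alive : ∀ {i} → i ≤ len → visit i ∈ₗ A

  module _ {A : List (Fin m)} {len : ℕ} (π : Path A len) where
    open Path π

    path-length : len < m
    path-length = injective⇒≤ {f = λ (i : Fin (suc len)) → visit (toℕ i)}
      λ {i} {j} eq → toℕ-injective (inj (ℕₚ.≤-pred (toℕ<n i)) (ℕₚ.≤-pred (toℕ<n j)) eq)

    path-closes : ∀ {k} → suc (suc k) ≤ len → Adj T (visit (suc (suc k))) (visit 0) → Cycle T k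
    path-closes {k} k≤ close = record
      { vert  = λ i → visit (toℕ i)
      ; inj   = λ {i} {j} eq → toℕ-injective (inj (bound i) (bound j) eq)
      ; cons  = λ i → subst (λ a → Adj T (visit a) (visit (suc (toℕ i)))) (≡.sym (toℕ-inject₁ i)) (adjac (ℕₚ.≤-trans (toℕ<n i) k≤))
      ; close = subst (λ a → Adj T (visit a) (visit 0)) (≡.sym (toℕ-fromℕ (suc (suc k)))) close
      }
      where
      bound : ∀ (i : Fin (suc (suc (suc k)))) → toℕ i ≤ len
      bound i = ℕₚ.≤-trans (ℕₚ.≤-pred (toℕ<n i)) k≤

    path-extend : ∀ {u} → u ∈ₗ A → Adj T u (visit 0) → (∀ {i} → i ≤ len → u ≢ visit i) → Path A (suc len)
    path-extend {u} u∈ u~ u∉ = record { visit = visit′ ; inj = inj′ ; adjac = adjac′ ; alive = alive′ }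
      where
      visit′ : ℕ → Fin m
      visit′ zero    = u
      visit′ (suc i) = visit i
      inj′ : ∀ {i j} → i ≤ suc len → j ≤ suc len → visit′ i ≡ visit′ j → i ≡ j
      inj′ {zero}  {zero}  _        _        _  = refl
      inj′ {zero}  {suc j} _        (s≤s j≤) eq = ⊥-elim (u∉ j≤ eq)
      inj′ {suc i} {zero}  (s≤s i≤) _        eq = ⊥-elim (u∉ i≤ (≡.sym eq))
      inj′ {suc i} {suc j} (s≤s i≤) (s≤s j≤) eq = cong suc (inj i≤ j≤ eq)
      adjac′ : ∀ {i} → i < suc len → Adj T (visit′ i) (visit′ (suc i))
      adjac′ {zero}  _        = u~
      adjac′ {suc i} (s≤s i<) = adjac i<
      alive′ : ∀ {i} → i ≤ suc len → visit′ i ∈ₗ A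
      alive′ {zero}  _        = u∈
      alive′ {suc i} (s≤s i≤) = alive i≤

  -- An `ℓ` isolated within `A` counts too, with any `s`.
  Leaf : List (Fin m) → Set
  Leaf A = ∃ λ ℓ → ℓ ∈ₗ A × ∃ λ s → ∀ {u} → u ∈ₗ A → Adj T ℓ u → u ≡ s

  -- A path that is prolonged without turning back cannot meet itself, hence stops at a
  -- leaf of the subgraph induced on A.
  path-leaf : Acyclic T → ∀ {A} fuel len → Path A len → m ≤ fuel + len → Leaf A
  path-leaf acyclic zero len π m≤ = ⊥-elim (ℕₚ.<⇒≱ (path-length π) m≤)
  path-leaf acyclic {A} (suc fuel) len π m≤
    with Any.any? (λ u → (adj T (Path.visit π 0) u Bool.≟ true) ×-dec ¬? (u ≟ Path.visit π 1)) A
  ... | no none = visit 0 , alive z≤n , visit 1 , λ {u} u∈ ~u → decidable-stable (u ≟ visit 1) (λ u≢ → none (lose u∈ (~u , u≢)))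
    where open Path π
  ... | yes some with find some
  ...   | u , u∈ , ~u , u≢ with any? (λ (i : Fin (suc len)) → u ≟ Path.visit π (toℕ i))
  ...     | no u∉ = path-leaf acyclic fuel (suc len)
                      (path-extend π u∈ (Adj-sym T ~u)
                        (λ {i} i≤ eq → u∉ (fromℕ< (s≤s i≤) , ≡.trans eq (cong (Path.visit π) (≡.sym (toℕ-fromℕ< (s≤s i≤)))))))
                      (subst (m ≤_) (≡.sym (ℕₚ.+-suc fuel len)) m≤)
  ...     | yes (i , eq) with toℕ i | ℕₚ.≤-pred (toℕ<n i)
  ...       | zero        | _  = ⊥-elim (Adj-irrefl T (subst (Adj T (Path.visit π 0)) eq ~u))
  ...       | suc zero    | _  = ⊥-elim (u≢ eq)
  ...       | suc (suc k) | k≤ = ⊥-elim (acyclic k (path-closes π k≤ (subst (λ v → Adj T v (Path.visit π 0)) eq (Adj-sym T ~u))))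

  acyclic-leaf : Acyclic T → ∀ {A r} → r ∈ₗ A → Leaf A
  acyclic-leaf acyclic {A} {r} r∈ = path-leaf acyclic m 0
    -- The default `visit 1` is `r` itself, so forbidding a step to it excludes no neighbour of `r`.
    (record { visit = λ _ → r ; inj = λ { z≤n z≤n _ → refl } ; adjac = λ () ; alive = λ _ → r∈ }) (ℕₚ.m≤m+n m 0)

  module _ {P : Fin m → Set} {ℓ s : Fin m} (nbr : ∀ {u} → P u → Adj T ℓ u → u ≡ s) where
    private
      P′ : Fin m → Set
      P′ t = t ≢ ℓ × P t

    -- A visit to `ℓ` enters from `s` and returns to `s`, so it can be cut out of the walk.
    walk-avoid  : ∀ {u v} → WalkIn T P u v → v ≢ ℓ → u ≢ ℓ → WalkIn T P′ u v
    walk-escape : ∀ {v} → WalkIn T P ℓ v → v ≢ ℓ → WalkIn T P′ s v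
    walk-avoid (here p) v≢ℓ u≢ℓ = here (u≢ℓ , p)
    walk-avoid {u} (step {v = w} p u~w walk) v≢ℓ u≢ℓ with w ≟ ℓ
    ... | yes refl = subst (λ a → WalkIn T P′ a _) (≡.sym (nbr p (Adj-sym T u~w))) (walk-escape walk v≢ℓ)
    ... | no  w≢ℓ  = step (u≢ℓ , p) u~w (walk-avoid walk v≢ℓ w≢ℓ)
    walk-escape (here _) v≢ℓ = ⊥-elim (v≢ℓ refl)
    walk-escape (step {v = w} p ℓ~w walk) v≢ℓ =
      subst (λ a → WalkIn T P′ a _) (nbr (walk-start walk) ℓ~w)
        (walk-avoid walk v≢ℓ (λ { refl → Adj-irrefl T ℓ~w }))

walk-weaken : ∀ {n} {G : Graph n} {P Q : Fin n → Set} → (∀ {u} → P u → Q u) → ∀ {u v} → WalkIn G P u v → WalkIn G Q u v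
walk-weaken = walk-map id id

-- From a tree decomposition of width 2 to a 2-tree

module _ {n m} {H : Graph n} {T : Graph (suc m)} (D : TreeDecomposition H T) (width : WidthAtMost 2 D) where

  -- The bags at `A` become cliques of the 2-tree. By `only`, a placed vertex is witnessed by a bag
  -- at `A`, which lets a new leaf bag be compared with its neighbour.
  record Covering (A : List (Fin (suc m))) : Set where
    field
      {placed} : List (Fin n)
      filling  : Filling placed
      covers   : ∀ {t v} → t ∈ₗ A → v ∈ bag D t → v ∈ₗ placed
      cliques  : ∀ {t u v} → t ∈ₗ A → u ∈ bag D t → v ∈ bag D t → u ≢ v → Filling.Adjacent filling u v
      only     : ∀ {v} → v ∈ₗ placed → ∃ λ t → t ∈ₗ A × v ∈ bag D t

  Subtrees : List (Fin (suc m)) → Set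
  Subtrees A = ∀ {v t₁ t₂} → t₁ ∈ₗ A → t₂ ∈ₗ A → v ∈ bag D t₁ → v ∈ bag D t₂ →
               WalkIn T (λ t → t ∈ₗ A × v ∈ bag D t) t₁ t₂

  module _ {A : List (Fin (suc m))} (subtrees : Subtrees A) {ℓ s : Fin (suc m)} (ℓ∈ : ℓ ∈ₗ A)
           (nbr : ∀ {u} → u ∈ₗ A → Adj T ℓ u → u ≡ s) where

    alive? : ∀ t → Dec (t ≢ ℓ)
    alive? t = ¬? (t ≟ ℓ)

    A′ : List (Fin (suc m))
    A′ = filter alive? A

    prune : ∀ {v u t} → WalkIn T (λ t → t ≢ ℓ × t ∈ₗ A × v ∈ bag D t) u t → WalkIn T (λ t → t ∈ₗ A′ × v ∈ bag D t) u t
    prune = walk-weaken (λ { (t≢ , t∈ , v∈) → ∈-filter⁺ alive? t∈ t≢ , v∈ })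

    subtrees′ : Subtrees A′
    subtrees′ t₁∈ t₂∈ v∈₁ v∈₂ =
      let t₁∈A , t₁≢ = ∈-filter⁻ alive? t₁∈
          t₂∈A , t₂≢ = ∈-filter⁻ alive? t₂∈
      in prune (walk-avoid (λ { (u∈ , _) → nbr u∈ }) (subtrees t₁∈A t₂∈A v∈₁ v∈₂) t₂≢ t₁≢)

    module _ (rest : Covering A′) where
      open Covering rest

      -- A walk from `ℓ` to another bag with `v` must pass through `s`. Hence the placed vertices of
      -- the leaf bag all lie in the bag of `s`, where they already form a clique.
      shared : ∀ {v} → v ∈ bag D ℓ → v ∈ₗ placed → s ∈ₗ A′ × v ∈ bag D s
      shared v∈ℓ v∈ = let t , t∈ , v∈t = only v∈
                          t∈A , t≢ = ∈-filter⁻ alive? t∈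
                      in walk-start (prune (walk-escape (λ { (u∈ , _) → nbr u∈ }) (subtrees ℓ∈ t∈A v∈ℓ v∈t) t≢))

      xs = elements (bag D ℓ)
      olds = filter (_∈? placed) xs
      news = filter (¬? ∘ (_∈? placed)) xs

      olds⇒ : ∀ {v} → v ∈ₗ olds → v ∈ bag D ℓ × v ∈ₗ placed
      olds⇒ v∈ = let v∈xs , v∈p = ∈-filter⁻ (_∈? placed) v∈ in ∈-elements⁻ _ v∈xs , v∈p

      old-clique : Filling.Clique filling olds
      old-clique u∈ v∈ u≢v = let u∈ℓ , u∈p = olds⇒ u∈
                                 v∈ℓ , v∈p = olds⇒ v∈
                                 s∈ , u∈s = shared u∈ℓ u∈p
                             in cliques s∈ u∈s (proj₂ (shared v∈ℓ v∈p)) u≢v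

      C : Completion filling olds news
      C = complete filling olds news (proj₂ ∘ olds⇒) old-clique (proj₂ ∘ ∈-filter⁻ (¬? ∘ (_∈? placed)) {xs = xs})
            (Unique.filter⁺ _ (elements-unique (bag D ℓ)))
            (subst (_≤ 3) (≡.sym (≡.trans (filter-length (_∈? placed) xs) (length-elements (bag D ℓ)))) (width ℓ))
      module C = Completion C

      sort : ∀ {v} → v ∈ bag D ℓ → v ∈ₗ olds ⊎ v ∈ₗ news
      sort {v} v∈ with v ∈? placed
      ... | yes v∈p = inj₁ (∈-filter⁺ (_∈? placed) (∈-elements⁺ v∈) v∈p)
      ... | no  v∉p = inj₂ (∈-filter⁺ (¬? ∘ (_∈? placed)) (∈-elements⁺ v∈) v∉p)

      covers′ : ∀ {t v} → t ∈ₗ A → v ∈ bag D t → v ∈ₗ C.placed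
      covers′ {t} t∈ v∈ with t ≟ ℓ
      ... | no t≢ = _≼_.keeps C.extends (covers (∈-filter⁺ alive? t∈ t≢) v∈)
      ... | yes refl = [ _≼_.keeps C.extends ∘ proj₂ ∘ olds⇒ , C.adds ]′ (sort v∈)

      cliques′ : ∀ {t u v} → t ∈ₗ A → u ∈ bag D t → v ∈ bag D t → u ≢ v → Filling.Adjacent C.filling u v
      cliques′ {t} t∈ u∈ v∈ u≢v with t ≟ ℓ
      ... | no t≢ = let t∈′ = ∈-filter⁺ alive? t∈ t≢ in
                    _≼_.adjacent C.extends (covers t∈′ u∈) (covers t∈′ v∈) (cliques t∈′ u∈ v∈ u≢v)
      ... | yes refl = C.clique (sort u∈) (sort v∈) u≢v

      only′ : ∀ {v} → v ∈ₗ C.placed → ∃ λ t → t ∈ₗ A × v ∈ bag D t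
      only′ v∈ with C.only v∈
      ... | inj₁ v∈p = let t , t∈ , v∈t = only v∈p in t , proj₁ (∈-filter⁻ alive? t∈) , v∈t
      ... | inj₂ v∈n = ℓ , ℓ∈ , ∈-elements⁻ _ (proj₁ (∈-filter⁻ (¬? ∘ (_∈? placed)) v∈n))

      attachLeaf : Covering A
      attachLeaf = record { filling = C.filling ; covers = covers′ ; cliques = cliques′ ; only = only′ }

  -- Induction on a bound for the number of tree nodes: remove a leaf, cover the others, then
  -- complete the leaf's bag.
  covering : ∀ k A → length A ≤ k → Subtrees A → Covering A
  covering k       []        _  _        = record { filling = empty ; covers = λ () ; cliques = λ () ; only = λ () }
  covering (suc k) A@(_ ∷ _) A≤ subtrees =
    let ℓ , ℓ∈ , s , nbr = acyclic-leaf (proj₂ (isTree D)) (here refl) in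
    attachLeaf subtrees ℓ∈ nbr (covering k _
      (ℕₚ.≤-pred (ℕₚ.≤-trans (filter-notAll (λ t → ¬? (t ≟ ℓ)) A (lose ℓ∈ (λ ℓ≢ → ℓ≢ refl))) A≤))
      (subtrees′ subtrees ℓ∈ nbr))

  full : Covering (allFin (suc m))
  full = covering _ (allFin (suc m)) ℕₚ.≤-refl
    (λ _ _ v∈₁ v∈₂ → walk-weaken (∈-allFin _ ,_) (subtree D _ _ _ v∈₁ v∈₂))

-- Assembling the universal graph

module _ {H : Set} {R : H → H → Set} (R-sym : ∀ {u v} → R u v → R v u) where
  open Embedding R R-sym

  vertexAt : ∀ {t} → H → H → (Pos t → H) → Vertex t → H
  vertexAt a b f rootᴬ  = a
  vertexAt a b f rootᴮ  = b
  vertexAt a b f (at x) = f x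

  private
    upˡ-at : ∀ {l r s a b} (f : Pos (node l r s) → H) v → vertexAt a (f top) (f ∘ inˡ) v ≡ vertexAt a b f (upˡ v)
    upˡ-at f rootᴬ  = refl
    upˡ-at f rootᴮ  = refl
    upˡ-at f (at _) = refl

    upʳ-at : ∀ {l r s a b} (f : Pos (node l r s) → H) v → vertexAt (f top) b (f ∘ inʳ) v ≡ vertexAt a b f (upʳ v)
    upʳ-at f rootᴬ  = refl
    upʳ-at f rootᴮ  = refl
    upʳ-at f (at _) = refl

    upˢ-at : ∀ {l r s a b} (f : Pos (node l r s) → H) v → vertexAt a b (f ∘ inˢ) v ≡ vertexAt a b f (upˢ v)
    upˢ-at f rootᴬ  = refl
    upˢ-at f rootᴮ  = refl
    upˢ-at f (at _) = refl

  Real-link : ∀ {t a b f} → Real t a b f → (e : Link t) → R (vertexAt a b f (src e)) (vertexAt a b f (tgt e))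
  Real-link ab           link     = ab
  Real-link (l , _ , _) (viaˡ e) = subst₂ R (upˡ-at _ (src e)) (upˡ-at _ (tgt e)) (Real-link l e)
  Real-link (_ , r , _) (viaʳ e) = subst₂ R (upʳ-at _ (src e)) (upʳ-at _ (tgt e)) (Real-link r e)
  Real-link (_ , _ , s) (viaˢ e) = subst₂ R (upˢ-at _ (src e)) (upˢ-at _ (tgt e)) (Real-link s e)

  Real-joined : ∀ {t a b f} → Real t a b f → ∀ {x y} → Joined t (at x) (at y) → R (f x) (f y)
  Real-joined {f = f} real (inj₁ (e , x≡ , y≡)) = subst₂ (λ v w → R (vertexAt _ _ f v) (vertexAt _ _ f w)) (≡.sym x≡) (≡.sym y≡) (Real-link real e)
  Real-joined {f = f} real (inj₂ (e , y≡ , x≡)) = R-sym (subst₂ (λ v w → R (vertexAt _ _ f v) (vertexAt _ _ f w)) (≡.sym y≡) (≡.sym x≡) (Real-link real e))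

-- The roots A and B of the 2-tree are auxiliary: only its other vertices represent
-- vertices of H.
treewidth2-subgraph : ∀ {n} (H : Graph n) → TreewidthAtMost 2 H →
  ∃ λ t → size t ≤ n × (∀ {N} (U : Graph N) {a b f} → Injective _≡_ _≡_ f →
    Embedding.Real (Adj U) (Adj-sym U) t a b f → SubgraphOf H U)
treewidth2-subgraph {n} H (m , T , D , width) = 2tree , subst (_≤ n) (≡.sym size≡) (unique-length unique) , subgraph
  where
  open Covering (full D width) renaming (filling to F)
  open Filling F
  here! : ∀ v → v ∈ₗ placed
  here! v = let t , v∈ = covV D v in covers (∈-allFin t) v∈
  x : ∀ v → ∃ λ x → vertex v ≡ at x
  x v = isPos (here! v)
  subgraph : ∀ {N} (U : Graph N) {a b f} → Injective _≡_ _≡_ f →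
             Embedding.Real (Adj U) (Adj-sym U) 2tree a b f → SubgraphOf H U
  subgraph U {f = f} f-inj real = (λ v → f (proj₁ (x v))) ,
    (λ {u} {v} eq → inj (here! u) (here! v) (≡.trans (proj₂ (x u)) (≡.trans (cong at (f-inj eq)) (≡.sym (proj₂ (x v)))))) ,
    (λ u v uv → let t , u∈ , v∈ = covE D u v uv in
      Real-joined (Adj-sym U) real (subst₂ (Joined 2tree) (proj₂ (x u)) (proj₂ (x v))
        (cliques (∈-allFin t) u∈ v∈ (λ { refl → Adj-irrefl H uv }))))

-- The first instruction joins a new vertex to slot 0, with all three attachments equal. This
-- creates the base edge that receives the auxiliary roots; the vertices of `H` go to spots of `p`.
run-contains : ∀ {p A ρ n} (r : Run (new 0F 0F 0F p) A ρ) → let G = graph (result r) in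
               (∀ t → size t ≤ n → Embedding.Embeds (Adj G) (Adj-sym G) t p 0F 1F) →
               (H : Graph n) → TreewidthAtMost 2 H → SubgraphOf H G
run-contains {ρ = ρ} r embeds H tw =
  let t , t≤n , subgraph = treewidth2-subgraph H tw
      open Embedding.Embeds (embeds t t≤n)
      root = ι (extension r) (ρ 0F)
      root~fresh , _ , _ , good = place-good r
  in subgraph (graph (result r)) (λ eq → inj (below-injective (place-inj r eq)))
       (real {ρ = newBag (place r fresh) root root root} {h = place r ∘ below} good root~fresh)

universal-contains : ∀ d {A ρ n} (r : Run (new 0F 0F 0F (Programs.universal (2 ^ d) d 0F 1F)) A ρ) → n < 2 ^ d →
                     (H : Graph n) → TreewidthAtMost 2 H → SubgraphOf H (graph (result r))
universal-contains d r n<2^d = run-contains r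
  (λ t t≤n → Embedding.universal-embeds _ _ (2 ^ d) d ℕₚ.≤-refl t 0F 1F (ℕₚ.≤-<-trans t≤n n<2^d))

universalRun : ∀ d → Run (new 0F 0F 0F (Programs.universal (2 ^ d) d 0F 1F)) point (λ _ → zero)
universalRun d = run _ point zero (λ _ → zero) (λ _ → here)

subgraph-point : ∀ {n} → n < 2 → (H : Graph n) → SubgraphOf H (graph point)
subgraph-point {zero}        _ H = (λ ()) , (λ { {()} }) , λ ()
subgraph-point {suc zero}    _ H = id , id , λ { zero zero uv → ⊥-elim (Adj-irrefl H uv) }
subgraph-point {suc (suc _)} (s≤s (s≤s ()))

theorem3p12 : ∀ (n : ℕ) → 1 ≤ n →
    Σ ℕ λ N → Σ (Graph N) λ U →
    TreewidthAtMost 3 U × PowLogBound N n ×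
    (∀ (H : Graph n) → TreewidthAtMost 2 H → SubgraphOf H U)
theorem3p12 n 1≤n with floor-log n 1≤n
-- Here n = 1, and the bound leaves room for a single vertex only.
... | zero , 1≤n′ , n<2 =
  _ , graph point , (_ , tree point , decomp point , width point) , powLogBound 0 1≤n′ (s≤s z≤n) , (λ H _ → subgraph-point n<2 H)
-- Depth `2 + j`, one above the floor of the logarithm, makes `n` strictly smaller than the power of
-- two that the host serves.
... | suc j , lo , hi =
  _ , graph U , (_ , tree U , decomp U , width U) , powLogBound (suc j) lo order≤ , universal-contains (2 + j) r hi
  where
  r = universalRun (2 + j)
  U = result r
  order≤ : order U ≤ 2 ^ (20 * (suc j * suc j))
  order≤ = subst (_≤ 2 ^ (20 * (suc j * suc j))) (≡.trans (cong suc (ℕₚ.+-comm 1 _)) (≡.sym (order-eq r))) (cost-bound j 0F 1F)
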